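{- Let $\tau_t(n)$ denote the maximum number of rainbow $t$-cliques in an almost $t$-Gallai colouring of $E(K_n)$. Then: (i) for every fixed $t \ge 3$, $\tau_t(n) = o(n^2)$ as $n \to \infty$; (ii) for every fixed $t \ge 4$, $\tau_t(n) \ge n^{2-o(1)}$ as $n \to \infty$. Moreover, the lower bound in (ii) is attained by almost $t$-Gallai colourings of $E(K_n)$ that use only $\binom{t}{2}$ colours.
   Context: For an integer $t \ge 3$, a colouring $c : E(K_n) \to \mathbb{N}$ of the edges of the complete graph $K_n$ is called almost $t$-Gallai if no two rainbow $t$-cliques share an edge, where a $t$-clique is rainbow if its $\binom{t}{2}$ edges receive pairwise distinct colours. -}

module Defs where

import Data.Bool.Properties as Bool
open import Data.Fin.Base using (Fin; zero; suc)
open import Data.Fin.Subset using (Subset; inside; outside; ∣_∣; ⁅_⁆; _∪_; _⊆_; _∈_)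
open import Data.Fin.Subset.Properties using (_⊆?_; _∈?_; nonempty?; Empty-unique; ∣⊥∣≡0; ∣⁅x⁆∣≡1; ∪-identityˡ; ∪-identityʳ; x∈⁅x⁆; x∈⁅y⁆⇒x≡y; x∈p∪q⁺; x∈p∪q⁻; ⊆-antisym)
open import Data.List.Base using (List; []; _∷_; _++_; map; filter; length; concatMap; upTo)
import Data.List.Extrema.Nat as Extrema
open import Data.List.Membership.Propositional using () renaming (_∈_ to _∈ˡ_)
open import Data.List.Membership.Propositional.Properties using (∈-map⁺; ∈-map⁻; ∈-++⁺ˡ; ∈-++⁺ʳ; ∈-filter⁺; ∈-concatMap⁺; ∈-upTo⁺)
open import Data.List.Properties using (length-map; filter-≐)
open import Data.List.Relation.Binary.Disjoint.Propositional using (Disjoint)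
open import Data.List.Relation.Unary.All as All using (All; all?)
open import Data.List.Relation.Unary.All.Properties using (all-filter)
open import Data.List.Relation.Unary.Any as Any using (here; there)
open import Data.List.Relation.Unary.AllPairs using ([]; _∷_)
open import Data.List.Relation.Unary.Unique.Propositional using (Unique)
import Data.List.Relation.Unary.Unique.Propositional.Properties as Unique
open import Data.Nat.Base using (ℕ; zero; suc; _*_; _^_; _≤_; _<_; _≥_; z≤n; s≤s; NonZero)
open import Data.Nat.Properties using (_≟_; ≡-irrelevant; suc-injective; ≤-reflexive; ≤-trans)
open import Data.Product.Base using (∃; _×_; _,_; proj₁; proj₂)
open import Data.Sum.Base using (inj₁; inj₂)
import Data.Vec.Base as Vec
import Data.Vec.Properties as Vec
open import Function.Base using (_∘_; const)
open import Relation.Binary.Definitions using (DecidableEquality)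
open import Relation.Binary.PropositionalEquality
open import Relation.Nullary using (¬_; Dec; yes; no; contradiction)
open import Relation.Nullary.Decidable using (map′; ¬?; _×-dec_; _→-dec_)
open import Relation.Unary using (Pred; Decidable)

private
  variable
    n k t : ℕ

-- Every set of vertices of Kₙ spans a clique, so a k-clique is a k-subset of Fin n.
Clique : ℕ → ℕ → Set
Clique n k = ∃ λ (S : Subset n) → ∣ S ∣ ≡ k

Edge : ℕ → Set
Edge n = Clique n 2

infix 4 _∈E_
_∈E_ : Edge n → Clique n k → Set
e ∈E K = proj₁ e ⊆ proj₁ K

Clique-≡ : {K L : Clique n k} → proj₁ K ≡ proj₁ L → K ≡ L
Clique-≡ {K = S , p} {L = _ , q} refl = cong (S ,_) (≡-irrelevant p q)

infix 4 _≟ᶜ_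
_≟ᶜ_ : DecidableEquality (Clique n k)
K ≟ᶜ L = map′ Clique-≡ (cong proj₁) (Vec.≡-dec Bool._≟_ (proj₁ K) (proj₁ L))

addOutside : Clique n k → Clique (suc n) k
addOutside (S , p) = outside Vec.∷ S , p

addInside : Clique n k → Clique (suc n) (suc k)
addInside (S , p) = inside Vec.∷ S , cong suc p

-- Every k-clique occurs exactly once: see ∈-cliques and cliques-unique.
cliques : ∀ n k → List (Clique n k)
cliques zero    zero    = (Vec.[] , refl) ∷ []
cliques zero    (suc k) = []
cliques (suc n) zero    = map addOutside (cliques n zero)
cliques (suc n) (suc k) = map addInside (cliques n k) ++ map addOutside (cliques n (suc k))

∈-cliques : (K : Clique n k) → K ∈ˡ cliques n k
∈-cliques {zero}  {zero}  (Vec.[] , refl) = here refl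
∈-cliques {suc n} {zero}  (outside Vec.∷ S , p) = ∈-map⁺ addOutside (∈-cliques (S , p))
∈-cliques {suc n} {suc k} (outside Vec.∷ S , p) =
  ∈-++⁺ʳ (map addInside (cliques n k)) (∈-map⁺ addOutside (∈-cliques (S , p)))
∈-cliques {suc n} {suc k} (inside Vec.∷ S , p) =
  ∈-++⁺ˡ (subst (_∈ˡ map addInside (cliques n k)) (Clique-≡ refl)
    (∈-map⁺ addInside (∈-cliques (S , suc-injective p))))

cliques-unique : ∀ n k → Unique (cliques n k)
cliques-unique zero    zero    = All.[] ∷ []
cliques-unique zero    (suc k) = []
cliques-unique (suc n) zero    =
  Unique.map⁺ (Clique-≡ ∘ Vec.∷-injectiveʳ ∘ cong proj₁) (cliques-unique n zero)
cliques-unique (suc n) (suc k) = Unique.++⁺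
  (Unique.map⁺ (Clique-≡ ∘ Vec.∷-injectiveʳ ∘ cong proj₁) (cliques-unique n k))
  (Unique.map⁺ (Clique-≡ ∘ Vec.∷-injectiveʳ ∘ cong proj₁) (cliques-unique n (suc k)))
  disjoint
  where
  disjoint : Disjoint (map addInside (cliques n k)) (map addOutside (cliques n (suc k)))
  disjoint (i , o) with ∈-map⁻ addInside i | ∈-map⁻ addOutside o
  ... | _ , _ , refl | _ , _ , q with cong (Vec.head ∘ proj₁) q
  ... | ()

allCliques? : ∀ {ℓ} {P : Pred (Clique n k) ℓ} → Decidable P → Dec (∀ K → P K)
allCliques? {n} {k} P? =
  map′ (λ ps K → All.lookup ps (∈-cliques K)) (λ h → All.universal h _) (all? P? (cliques n k))

anyClique? : ∀ {ℓ} {P : Pred (Clique n k) ℓ} → Decidable P → Dec (∃ P)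
anyClique? {n} {k} P? = map′ Any.satisfied (λ (K , p) → Any.map (λ { refl → p }) (∈-cliques K))
  (Any.any? P? (cliques n k))

Colouring : ℕ → Set
Colouring n = Edge n → ℕ

Rainbow : Colouring n → Clique n k → Set
Rainbow c K = ∀ e f → e ∈E K → f ∈E K → c e ≡ c f → e ≡ f

rainbow? : (c : Colouring n) → Decidable (Rainbow {k = k} c)
rainbow? c K = allCliques? λ e → allCliques? λ f →
  (proj₁ e ⊆? proj₁ K) →-dec (proj₁ f ⊆? proj₁ K) →-dec (c e ≟ c f) →-dec (e ≟ᶜ f)

AlmostGallai : ℕ → Colouring n → Set
AlmostGallai {n} t c = ∀ (K L : Clique n t) → Rainbow c K → Rainbow c L → K ≢ L →
  ¬ ∃ λ (e : Edge n) → e ∈E K × e ∈E L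

almostGallai? : ∀ t → Decidable (AlmostGallai {n} t)
almostGallai? t c = allCliques? λ K → allCliques? λ L →
  rainbow? c K →-dec rainbow? c L →-dec ¬? (K ≟ᶜ L) →-dec
  ¬? (anyClique? λ e → (proj₁ e ⊆? proj₁ K) ×-dec (proj₁ e ⊆? proj₁ L))

rainbowCount : ℕ → Colouring n → ℕ
rainbowCount {n} t c = length (filter (rainbow? c) (cliques n t))

UsesAtMost : ℕ → Colouring n → Set
UsesAtMost m c = ∃ λ (palette : List ℕ) → length palette ≡ m × (∀ e → c e ∈ˡ palette)

IsMaxRainbowCount : (t n m : ℕ) → Set
IsMaxRainbowCount t n m =
  (∃ λ (c : Colouring n) → AlmostGallai t c × rainbowCount t c ≡ m) ×
  (∀ (c : Colouring n) → AlmostGallai t c → rainbowCount t c ≤ m)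

-- Although there are infinitely many colourings
-- by natural numbers, everything depends only on which edges share a colour,
-- so finitely many candidates suffice for the maximum.

private

  ∣pair∣ : (x y : Fin n) → x ≢ y → ∣ ⁅ x ⁆ ∪ ⁅ y ⁆ ∣ ≡ 2
  ∣pair∣ zero    zero    x≢y = contradiction refl x≢y
  ∣pair∣ zero    (suc y) x≢y =
    cong suc (trans (cong ∣_∣ (∪-identityˡ ⁅ y ⁆)) (∣⁅x⁆∣≡1 y))
  ∣pair∣ (suc x) zero    x≢y =
    cong suc (trans (cong ∣_∣ (∪-identityʳ ⁅ x ⁆)) (∣⁅x⁆∣≡1 x))
  ∣pair∣ (suc x) (suc y) x≢y = ∣pair∣ x y (x≢y ∘ cong suc)

  endpoint : (e : Edge n) → ∃ (_∈ proj₁ e)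
  endpoint {n} (S , p) with nonempty? S
  ... | yes ne = ne
  ... | no ¬ne with trans (sym p) (trans (cong ∣_∣ (Empty-unique ¬ne)) (∣⊥∣≡0 n))
  ... | ()

  constant : Colouring n
  constant = const 0

  rainbow-constant : (K : Clique n k) → Rainbow constant K → ∀ e → e ∈E K → proj₁ K ≡ proj₁ e
  rainbow-constant {n} K rb e e∈K = ⊆-antisym K⊆e e∈K
    where
    K⊆e : proj₁ K ⊆ proj₁ e
    K⊆e {x} x∈K with x ∈? proj₁ e
    ... | yes x∈e = x∈e
    ... | no  x∉e = contradiction (subst (x ∈_) (cong proj₁ f≡e) (x∈p∪q⁺ (inj₂ (x∈⁅x⁆ x)))) x∉e
      where
      a   = proj₁ (endpoint e)
      a∈e = proj₂ (endpoint e)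
      f : Edge n
      f = ⁅ a ⁆ ∪ ⁅ x ⁆ , ∣pair∣ a x (λ a≡x → x∉e (subst (_∈ proj₁ e) a≡x a∈e))
      f∈K : f ∈E K
      f∈K y∈f with x∈p∪q⁻ ⁅ a ⁆ ⁅ x ⁆ y∈f
      ... | inj₁ y∈a = subst (_∈ proj₁ K) (sym (x∈⁅y⁆⇒x≡y a y∈a)) (e∈K a∈e)
      ... | inj₂ y∈x = subst (_∈ proj₁ K) (sym (x∈⁅y⁆⇒x≡y x y∈x)) x∈K
      f≡e : f ≡ e
      f≡e = rb f e f∈K e∈K refl

  almostGallai-constant : ∀ t → AlmostGallai {n} t constant
  almostGallai-constant t K L rbK rbL K≢L (e , e∈K , e∈L) = K≢L (Clique-≡
    (trans (rainbow-constant K rbK e e∈K) (sym (rainbow-constant L rbL e e∈L))))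

  infix 4 _⊑_
  _⊑_ : Colouring n → Colouring n → Set
  c ⊑ d = ∀ e f → c e ≡ c f → d e ≡ d f

  rainbow-⊑ : {c d : Colouring n} → c ⊑ d → (K : Clique n k) → Rainbow d K → Rainbow c K
  rainbow-⊑ c⊑d K rb e f e∈K f∈K eq = rb e f e∈K f∈K (c⊑d e f eq)

  almostGallai-⊑ : {c d : Colouring n} → c ⊑ d → AlmostGallai t c → AlmostGallai t d
  almostGallai-⊑ c⊑d ag K L rbK rbL = ag K L (rainbow-⊑ c⊑d K rbK) (rainbow-⊑ c⊑d L rbL)

  rainbowCount-⊑ : {c d : Colouring n} → c ⊑ d → d ⊑ c → rainbowCount t c ≡ rainbowCount t d
  rainbowCount-⊑ {n} {t} {c} {d} c⊑d d⊑c = cong length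
    (filter-≐ (rainbow? c) (rainbow? d)
      ((λ {K} → rainbow-⊑ d⊑c K) , (λ {K} → rainbow-⊑ c⊑d K)) (cliques n t))

  index : ℕ → List ℕ → ℕ
  index x []       = 0
  index x (y ∷ ys) with x ≟ y
  ... | yes _ = 0
  ... | no  _ = suc (index x ys)

  index-≤ : ∀ x ys → index x ys ≤ length ys
  index-≤ x []       = z≤n
  index-≤ x (y ∷ ys) with x ≟ y
  ... | yes _ = z≤n
  ... | no  _ = s≤s (index-≤ x ys)

  index-injective : ∀ {x x′ ys} → x ∈ˡ ys → x′ ∈ˡ ys → index x ys ≡ index x′ ys → x ≡ x′
  index-injective {x} {x′} {y ∷ ys} p q eq with x ≟ y | x′ ≟ y
  index-injective p q eq | yes refl | yes refl = refl
  index-injective p q () | yes _    | no _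
  index-injective p q () | no _     | yes _
  index-injective (here r)  _         eq | no x≢y | no _    = contradiction r x≢y
  index-injective (there _) (here r)  eq | no _   | no x′≢y = contradiction r x′≢y
  index-injective (there p) (there q) eq | no _   | no _    = index-injective p q (suc-injective eq)

  colourList : Colouring n → List ℕ
  colourList {n} c = map c (cliques n 2)

  normalise : Colouring n → Colouring n
  normalise c e = index (c e) (colourList c)

  ⊑-normalise : (c : Colouring n) → c ⊑ normalise c
  ⊑-normalise c e f = cong (λ x → index x (colourList c))

  normalise-⊑ : (c : Colouring n) → normalise c ⊑ c
  normalise-⊑ c e f = index-injective (∈-map⁺ c (∈-cliques e)) (∈-map⁺ c (∈-cliques f))

  numColours : ℕ → ℕ
  numColours n = suc (length (cliques n 2))

  normalise-< : (c : Colouring n) → ∀ e → normalise c e < numColours n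
  normalise-< {n} c e =
    s≤s (≤-trans (index-≤ (c e) (colourList c)) (≤-reflexive (length-map c (cliques n 2))))

  update : Colouring n → Edge n → ℕ → Colouring n
  update c e i f with f ≟ᶜ e
  ... | yes _ = i
  ... | no  _ = c f

  colouringsOn : List (Edge n) → List (Colouring n)
  colouringsOn     []       = constant ∷ []
  colouringsOn {n} (e ∷ es) =
    concatMap (λ c → map (update c e) (upTo (numColours n))) (colouringsOn es)

  colouringsOn-complete : (c : Colouring n) → (∀ e → c e < numColours n) → ∀ es →
    ∃ λ d → d ∈ˡ colouringsOn es × (∀ {e} → e ∈ˡ es → d e ≡ c e)
  colouringsOn-complete c bd [] = constant , here refl , λ ()
  colouringsOn-complete {n} c bd (e ∷ es) with colouringsOn-complete c bd es
  ... | d , d∈ , d≗c = update d e (c e) , member , agree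
    where
    member : update d e (c e) ∈ˡ colouringsOn (e ∷ es)
    member = ∈-concatMap⁺ (λ c → map (update c e) (upTo (numColours n)))
      (Any.map (λ { refl → ∈-map⁺ (update d e) (∈-upTo⁺ (bd e)) }) d∈)
    agree : ∀ {f} → f ∈ˡ e ∷ es → update d e (c e) f ≡ c f
    agree {f} f∈ with f ≟ᶜ e
    agree     _         | yes refl = refl
    agree     (here r)  | no f≢e   = contradiction r f≢e
    agree     (there p) | no _     = d≗c p

  candidates : ∀ t n → List (Colouring n)
  candidates t n = filter (almostGallai? t) (colouringsOn (cliques n 2))

  candidates-complete : (c : Colouring n) → AlmostGallai t c →
    ∃ λ d → d ∈ˡ candidates t n × rainbowCount t c ≡ rainbowCount t d
  candidates-complete {n} {t} c ag
    with colouringsOn-complete (normalise c) (normalise-< c) (cliques n 2)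
  ... | d , d∈ , d≗ =
    d , ∈-filter⁺ (almostGallai? t) d∈ (almostGallai-⊑ c⊑d ag) , rainbowCount-⊑ c⊑d d⊑c
    where
    c⊑d : c ⊑ d
    c⊑d e f eq = trans (d≗ (∈-cliques e)) (trans (⊑-normalise c e f eq) (sym (d≗ (∈-cliques f))))
    d⊑c : d ⊑ c
    d⊑c e f eq =
      normalise-⊑ c e f (trans (sym (d≗ (∈-cliques e))) (trans eq (d≗ (∈-cliques f))))

abstract
  maxRainbowCount : ∀ t n → ∃ (IsMaxRainbowCount t n)
  maxRainbowCount t n = rainbowCount t best , (best , best-ag , refl) , best-max
    where
    best : Colouring n
    best = Extrema.argmax (rainbowCount t) constant (candidates t n)
    best-ag : AlmostGallai t best
    best-ag = Extrema.argmax-all (rainbowCount t) {P = AlmostGallai t}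
      (almostGallai-constant t) (all-filter (almostGallai? t) (colouringsOn (cliques n 2)))
    best-max : (c : Colouring n) → AlmostGallai t c → rainbowCount t c ≤ rainbowCount t best
    best-max c ag = let d , d∈ , eq = candidates-complete c ag in ≤-trans (≤-reflexive eq)
      (All.lookup (Extrema.f[xs]≤f[argmax] {f = rainbowCount t} constant (candidates t n)) d∈)

τ : ℕ → ℕ → ℕ
τ t n = proj₁ (maxRainbowCount t n)

τ-isMax : ∀ t n → IsMaxRainbowCount t n (τ t n)
τ-isMax t n = proj₂ (maxRainbowCount t n)

-- Asymptotics as n → ∞.  The real ε > 0 of the usual definitions is taken
-- to be a positive rational p / q, and denominators are cleared.

-- f(n) = o(g(n)): for every ε, eventually f(n) ≤ ε g(n).
LittleO : (ℕ → ℕ) → (ℕ → ℕ) → Set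
LittleO f g = ∀ p q .{{_ : NonZero p}} .{{_ : NonZero q}} →
  ∃ λ N → ∀ n → n ≥ N → q * f n ≤ p * g n

-- f(n) ≥ n^(a - o(1)): for every ε, eventually f(n) ≥ n^(a - ε), that is,
-- n^(a q) ≤ f(n)^q n^p.
n^[_-o1]≤_ : ℕ → (ℕ → ℕ) → Set
n^[ a -o1]≤ f = ∀ p q .{{_ : NonZero p}} .{{_ : NonZero q}} →
  ∃ λ N → ∀ n → n ≥ N → n ^ (a * q) ≤ f n ^ q * n ^ p

{-# OPTIONS --safe #-}
module Submission where

-- Upper bound.  Map the colours to the pairs i < j so that a positive proportion of the rainbow
-- cliques, with vertices v₀ < … < vₜ₋₁, have v_i v_j in the class (i , j); then every t-tuple whose
-- edges lie in the right classes is a rainbow clique.  Keep a partition of the vertices and, for each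
-- (i , j), a set of pairs of parts declared sparse, of density at most 1/M in the class (i , j).  Few of
-- the edge-disjoint cliques meet a sparse pair or a small part.  For any other clique, embed greedily into
-- the parts of its vertices: success yields two rainbow cliques sharing an edge, so some step fails, and
-- failure exhibits a subrectangle of density at most 1/M and of positive relative area in a pair of parts
-- not yet sparse.  Declare all these rectangles sparse and refine the partition.  By edge-disjointness
-- the sparse area grows by a fixed proportion of n², which can happen only boundedly often.
--
-- Lower bound.  Vertices are pairs (i , x) with i < t and x in a box of ℤᴰ.  Two vertices with distinct i
-- are linked if their slope Δx / Δi is a vector a of the box with |a|² = r; a linked edge gets the colour
-- {i , j}, and all other edges share one colour with the linked edges {0 , 1}.  A rainbow clique has at
-- most one edge that is not linked, so (as t ≥ 4) two of its vertices form linked triangles with every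
-- other vertex.  The three slopes of a linked triangle are equal because one is a weighted average of the
-- other two and spheres contain no three collinear points.  Hence rainbow cliques are the lines
-- {(i , x + i a)}, and a line is determined by two of its points.  For a popular r these lines number
-- n² up to a factor of order n^(2/D).

open import Defs
open import Data.Bool.Base using (Bool; true; false; _∧_; _∨_; not)
import Data.Bool.Properties as Bool
open import Data.Empty using (⊥)
open import Data.Fin.Base as Fin using (Fin; zero; suc; toℕ; fromℕ<; inject≤; combine; remQuot; funToFin; finToFun)
import Data.Fin.Properties as Fin
import Data.Fin.Subset as Sub
import Data.Fin.Subset.Properties as Sub
open import Data.Integer.Base as ℤ using (ℤ; -[1+_]) renaming (+_ to ⁺_)
import Data.Integer.Properties as ℤ
import Data.Integer.Tactic.RingSolver as ℤ
open import Data.List.Base using (List; []; _∷_; _++_; map; length; lookup; filter; tabulate; allFin; upTo; cartesianProduct)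
import Data.List.Extrema.Nat as Extrema
import Data.List.Membership.DecPropositional as DecMembership
open import Data.List.Membership.Propositional using (_∈_; _∉_)
open import Data.List.Membership.Propositional.Properties using (∈-∃++; ∈-++⁻; ∈-++⁺ˡ; ∈-++⁺ʳ; ∈-map⁺; ∈-map⁻; ∈-filter⁺; ∈-filter⁻; ∈-allFin; ∈-upTo⁺; ∈-cartesianProduct⁺; ∈-length)
open import Data.List.Properties using (length-map; length-++; length-tabulate)
open import Data.List.Relation.Unary.All as All using ([]; _∷_)
import Data.List.Relation.Unary.All.Properties as All
open import Data.List.Relation.Unary.AllPairs using ([]; _∷_)
open import Data.List.Relation.Unary.Any as Any using (here; there)
open import Data.List.Relation.Unary.Any.Properties using (lookup-index)
open import Data.List.Relation.Unary.Unique.Propositional using (Unique)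
import Data.List.Relation.Unary.Unique.Propositional.Properties as Unique
open import Data.Maybe.Base using (Maybe; just; nothing; is-nothing)
open import Data.Maybe.Properties using (just-injective)
open import Data.Nat.Base
open import Data.Nat.Combinatorics using (_C_; nCk+nC[k+1]≡[n+1]C[k+1])
open import Data.Nat.Properties
open import Data.Nat.Tactic.RingSolver using (solve-∀)
open import Data.Product.Base using (∃; ∃₂; _×_; _,_; proj₁; proj₂)
open import Data.Sum.Base using (_⊎_; inj₁; inj₂)
import Data.Vec.Base as Vec
import Data.Vec.Properties as Vec
open import Function.Base using (_∘_; id)
open import Function.Definitions using (Injective)
open import Relation.Binary.Definitions using (tri<; tri≈; tri>)
open import Relation.Binary.PropositionalEquality
open import Relation.Nullary using (¬_; Dec; yes; no; does; contradiction)
open import Relation.Nullary.Decidable using (map′; ¬?; _×-dec_; _→-dec_; dec-true; dec-false; decidable-stable)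
open import Relation.Unary using (Pred; Decidable)
open import Algebra.Properties.CommutativeSemigroup +-commutativeSemigroup using () renaming (interchange to +-interchange; x∙yz≈y∙xz to +-left-comm)
open import Algebra.Properties.CommutativeSemigroup *-commutativeSemigroup using () renaming (interchange to *-interchange; x∙yz≈y∙xz to *-left-comm)

private
  variable
    X Y : Set
    n t k m D N q : ℕ

-- Finite sums

∑ : List X → (X → ℕ) → ℕ
∑ []       f = 0
∑ (x ∷ xs) f = f x + ∑ xs f

syntax ∑ xs (λ x → e) = ∑[ x ∈ xs ] e

⟦_⟧ : Bool → ℕ
⟦ true  ⟧ = 1
⟦ false ⟧ = 0

⟦⟧≤1 : ∀ b → ⟦ b ⟧ ≤ 1
⟦⟧≤1 true  = ≤-refl
⟦⟧≤1 false = z≤n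

⟦∧⟧ : ∀ a b → ⟦ a ∧ b ⟧ ≡ ⟦ a ⟧ * ⟦ b ⟧
⟦∧⟧ true  b = sym (+-identityʳ _)
⟦∧⟧ false b = refl

∑-mono∈ : ∀ (xs : List X) {f g} → (∀ {x} → x ∈ xs → f x ≤ g x) → ∑ xs f ≤ ∑ xs g
∑-mono∈ []       h = z≤n
∑-mono∈ (x ∷ xs) h = +-mono-≤ (h (here refl)) (∑-mono∈ xs (h ∘ there))

∑-mono : ∀ (xs : List X) {f g} → (∀ x → f x ≤ g x) → ∑ xs f ≤ ∑ xs g
∑-mono xs h = ∑-mono∈ xs λ {x} _ → h x

∑-cong : ∀ (xs : List X) {f g} → (∀ x → f x ≡ g x) → ∑ xs f ≡ ∑ xs g
∑-cong []       h = refl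
∑-cong (x ∷ xs) h = cong₂ _+_ (h x) (∑-cong xs h)

∑-distrib-+ : ∀ (xs : List X) f g → ∑[ x ∈ xs ] (f x + g x) ≡ ∑ xs f + ∑ xs g
∑-distrib-+ []       f g = refl
∑-distrib-+ (x ∷ xs) f g = trans (cong (f x + g x +_) (∑-distrib-+ xs f g))
  (+-interchange (f x) (g x) (∑ xs f) (∑ xs g))

*-distribˡ-∑ : ∀ c (xs : List X) f → c * ∑ xs f ≡ ∑[ x ∈ xs ] (c * f x)
*-distribˡ-∑ c []       f = *-zeroʳ c
*-distribˡ-∑ c (x ∷ xs) f = trans (*-distribˡ-+ c (f x) (∑ xs f)) (cong (c * f x +_) (*-distribˡ-∑ c xs f))

*-distribʳ-∑ : ∀ c (xs : List X) f → ∑ xs f * c ≡ ∑[ x ∈ xs ] (f x * c)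
*-distribʳ-∑ c xs f = trans (*-comm (∑ xs f) c) (trans (*-distribˡ-∑ c xs f) (∑-cong xs λ x → *-comm c (f x)))

∑-const : ∀ (xs : List X) c → ∑[ _ ∈ xs ] c ≡ length xs * c
∑-const []       c = refl
∑-const (x ∷ xs) c = cong (c +_) (∑-const xs c)

∑-≤-const : ∀ (xs : List X) {f c} → (∀ x → f x ≤ c) → ∑ xs f ≤ length xs * c
∑-≤-const xs {c = c} h = ≤-trans (∑-mono xs h) (≤-reflexive (∑-const xs c))

∑-zero : ∀ (xs : List X) → ∑[ _ ∈ xs ] 0 ≡ 0
∑-zero xs = trans (∑-const xs 0) (*-zeroʳ (length xs))

∑-one : ∀ (xs : List X) → ∑[ _ ∈ xs ] 1 ≡ length xs
∑-one xs = trans (∑-const xs 1) (*-identityʳ (length xs))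

∑-swap : ∀ (xs : List X) (ys : List Y) (f : X → Y → ℕ) →
  ∑[ x ∈ xs ] ∑[ y ∈ ys ] f x y ≡ ∑[ y ∈ ys ] ∑[ x ∈ xs ] f x y
∑-swap []       ys f = sym (∑-zero ys)
∑-swap (x ∷ xs) ys f = trans (cong (∑ ys (f x) +_) (∑-swap xs ys f))
  (sym (∑-distrib-+ ys (f x) (λ y → ∑[ x ∈ xs ] f x y)))

∑-++ : ∀ (xs ys : List X) f → ∑ (xs ++ ys) f ≡ ∑ xs f + ∑ ys f
∑-++ []       ys f = refl
∑-++ (x ∷ xs) ys f = trans (cong (f x +_) (∑-++ xs ys f)) (sym (+-assoc (f x) _ _))

∑-map : ∀ (h : X → Y) xs f → ∑ (map h xs) f ≡ ∑ xs (f ∘ h)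
∑-map h []       f = refl
∑-map h (x ∷ xs) f = cong (f (h x) +_) (∑-map h xs f)

∑-product : ∀ (xs : List X) (ys : List Y) f g →
  ∑[ x ∈ xs ] ∑[ y ∈ ys ] (f x * g y) ≡ ∑ xs f * ∑ ys g
∑-product xs ys f g = trans (∑-cong xs λ x → sym (*-distribˡ-∑ (f x) ys g)) (sym (*-distribʳ-∑ (∑ ys g) xs f))

∑-× : ∀ (xs : List X) (ys : List Y) f →
  ∑ (cartesianProduct xs ys) f ≡ ∑[ x ∈ xs ] ∑[ y ∈ ys ] f (x , y)
∑-× []       ys f = refl
∑-× (x ∷ xs) ys f = trans (∑-++ (map (x ,_) ys) _ f) (cong₂ _+_ (∑-map (x ,_) ys f) (∑-× xs ys f))

term≤∑ : ∀ {xs : List X} {x} f → x ∈ xs → f x ≤ ∑ xs f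
term≤∑ f (here refl) = m≤m+n _ _
term≤∑ {xs = y ∷ _} f (there p) = ≤-trans (term≤∑ f p) (m≤n+m _ (f y))

∑-unique-⊆ : ∀ {xs ys : List X} g → Unique xs → (∀ {x} → x ∈ xs → x ∈ ys) → ∑ xs g ≤ ∑ ys g
∑-unique-⊆ {xs = []}     g u s = z≤n
∑-unique-⊆ {xs = x ∷ xs} g (x∉ ∷ u) s with ∈-∃++ (s (here refl))
... | as , bs , refl = begin
  g x + ∑ xs g            ≤⟨ +-monoʳ-≤ (g x) (∑-unique-⊆ g u s′) ⟩
  g x + ∑ (as ++ bs) g    ≡⟨ cong (g x +_) (∑-++ as bs g) ⟩
  g x + (∑ as g + ∑ bs g) ≡⟨ +-left-comm (g x) (∑ as g) (∑ bs g) ⟩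
  ∑ as g + (g x + ∑ bs g) ≡⟨ ∑-++ as (x ∷ bs) g ⟨
  ∑ (as ++ x ∷ bs) g      ∎
  where
  open ≤-Reasoning
  s′ : ∀ {y} → y ∈ xs → y ∈ as ++ bs
  s′ y∈ with ∈-++⁻ as (s (there y∈))
  ... | inj₁ p           = ∈-++⁺ˡ p
  ... | inj₂ (here refl) = contradiction refl (All.lookup x∉ y∈)
  ... | inj₂ (there p)   = ∈-++⁺ʳ as p

unique-map∈ : ∀ {xs : List X} (f : X → Y) →
  (∀ {x y} → x ∈ xs → y ∈ xs → f x ≡ f y → x ≡ y) → Unique xs → Unique (map f xs)
unique-map∈ f inj []       = []
unique-map∈ f inj (x∉ ∷ u) =
  All.map⁺ (All.tabulate λ y∈ eq → All.lookup x∉ y∈ (inj (here refl) (there y∈) eq))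
  ∷ unique-map∈ f (λ p q → inj (there p) (there q)) u

∑-injective-≤ : ∀ {xs : List X} {ys : List Y} (f : X → Y) g →
  (∀ {x y} → x ∈ xs → y ∈ xs → f x ≡ f y → x ≡ y) → (∀ {x} → x ∈ xs → f x ∈ ys) →
  Unique xs → ∑[ x ∈ xs ] g (f x) ≤ ∑ ys g
∑-injective-≤ {xs = xs} {ys} f g inj f∈ u = begin
  ∑ xs (g ∘ f)   ≡⟨ ∑-map f xs g ⟨
  ∑ (map f xs) g ≤⟨ ∑-unique-⊆ g (unique-map∈ f inj u) sub ⟩
  ∑ ys g         ∎
  where
  open ≤-Reasoning
  sub : ∀ {y} → y ∈ map f xs → y ∈ ys
  sub y∈ with ∈-map⁻ f y∈
  ... | _ , x∈ , refl = f∈ x∈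

length-injective-≤ : ∀ {xs : List X} {ys : List Y} (f : X → Y) →
  (∀ {x y} → x ∈ xs → y ∈ xs → f x ≡ f y → x ≡ y) → (∀ {x} → x ∈ xs → f x ∈ ys) →
  Unique xs → length xs ≤ length ys
length-injective-≤ {xs = xs} {ys} f inj f∈ u =
  subst₂ _≤_ (∑-one xs) (∑-one ys) (∑-injective-≤ f (λ _ → 1) inj f∈ u)

-- Pigeonhole without division: the witness is an element where `f` is largest.
∑-averaging : ∀ {S} (xs : List X) f → 0 < length xs → S ≤ ∑ xs f → ∃ λ x → x ∈ xs × S ≤ length xs * f x
∑-averaging {S = S} xs@(x₀ ∷ _) f _ X≤ with argmax xs
  where
  argmax : ∀ ys → (∃ λ x → x ∈ ys × (∀ {y} → y ∈ ys → f y ≤ f x)) ⊎ ys ≡ []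
  argmax []       = inj₂ refl
  argmax (y ∷ ys) with argmax ys
  ... | inj₂ refl = inj₁ (y , here refl , λ { (here refl) → ≤-refl })
  ... | inj₁ (x , x∈ , mx) with ≤-total (f x) (f y)
  ... | inj₁ le = inj₁ (y , here refl , λ { (here refl) → ≤-refl ; (there p) → ≤-trans (mx p) le })
  ... | inj₂ ge = inj₁ (x , there x∈ , λ { (here refl) → ge ; (there p) → mx p })
... | inj₁ (x , x∈ , mx) = x , x∈ , ≤-trans X≤ (≤-trans (∑-mono∈ xs mx) (≤-reflexive (∑-const xs (f x))))

∑-filter : ∀ {ℓ} {P : Pred X ℓ} (P? : Decidable P) xs → ∑[ x ∈ xs ] ⟦ does (P? x) ⟧ ≡ length (filter P? xs)
∑-filter P? []       = refl
∑-filter P? (x ∷ xs) with does (P? x)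
... | true  = cong suc (∑-filter P? xs)
... | false = ∑-filter P? xs

∑ᶠ : ∀ n → (Fin n → ℕ) → ℕ
∑ᶠ n = ∑ (allFin n)

syntax ∑ᶠ n (λ x → e) = ∑[ x < n ] e

length-allFin : ∀ n → length (allFin n) ≡ n
length-allFin n = length-tabulate {n = n} id

∑-tabulate : ∀ {n} (h : Fin n → X) f → ∑ (tabulate h) f ≡ ∑[ i < n ] f (h i)
∑-tabulate {n = zero}  h f = refl
∑-tabulate {n = suc n} h f = cong (f (h zero) +_)
  (trans (∑-tabulate (h ∘ suc) f) (sym (∑-tabulate suc (f ∘ h))))

∑ᶠ-suc : ∀ {n} f → ∑ᶠ (suc n) f ≡ f zero + ∑[ i < n ] f (suc i)
∑ᶠ-suc {n} f = cong (f zero +_) (∑-tabulate {n = n} suc f)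

∑-δ : ∀ {k} (b : Fin k) c → ∑[ a < k ] (⟦ does (b Fin.≟ a) ⟧ * c) ≡ c
∑-δ {suc k} zero c = trans (∑ᶠ-suc {k} (λ a → ⟦ does (zero Fin.≟ a) ⟧ * c)) (trans (cong (1 * c +_)
  (∑-zero (allFin k))) (trans (+-identityʳ _) (*-identityˡ c)))
∑-δ {suc k} (suc b) c = trans (∑ᶠ-suc {k} (λ a → ⟦ does (suc b Fin.≟ a) ⟧ * c)) (∑-δ b c)

-- One-sided regularity and the removal argument

infix 4 _∋_ _⊑_
_∋_ : (Fin n → Bool) → Fin n → Set
A ∋ x = A x ≡ true

_⊑_ : (Fin n → Bool) → (Fin n → Bool) → Set
A ⊑ B = ∀ x → A ∋ x → B ∋ x

card : (Fin n → Bool) → ℕ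
card {n} A = ∑[ x < n ] ⟦ A x ⟧

edges : (Fin n → Fin n → Bool) → (Fin n → Bool) → (Fin n → Bool) → ℕ
edges {n} E A B = ∑[ x < n ] (⟦ A x ⟧ * card (λ y → B y ∧ E x y))

card-cons : (A : Fin (suc n) → Bool) → card A ≡ ⟦ A zero ⟧ + card (A ∘ suc)
card-cons A = ∑ᶠ-suc (⟦_⟧ ∘ A)

inhabited : (A : Fin n → Bool) → 1 ≤ card A → ∃ (A ∋_)
inhabited {suc n} A 1≤ with A zero in eq | card-cons A
... | true  | _  = zero , eq
... | false | ce = let x , x∈ = inhabited (A ∘ suc) (≤-trans 1≤ (≤-reflexive ce)) in suc x , x∈

twoElements : (A : Fin n → Bool) → 2 ≤ card A → ∃₂ λ x y → A ∋ x × A ∋ y × x ≢ y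
twoElements {suc n} A 2≤ with A zero in eq | card-cons A
... | true  | ce =
  let y , y∈ = inhabited (A ∘ suc) (s≤s⁻¹ (≤-trans 2≤ (≤-reflexive ce)))
  in zero , suc y , eq , y∈ , λ ()
... | false | ce =
  let x , y , x∈ , y∈ , x≢y = twoElements (A ∘ suc) (≤-trans 2≤ (≤-reflexive ce))
  in suc x , suc y , x∈ , y∈ , x≢y ∘ Fin.suc-injective

∧-true : ∀ a {b} → a ∧ b ≡ true → a ≡ true × b ≡ true
∧-true true eq = refl , eq

true-∧ : ∀ {a b} → a ≡ true → b ≡ true → a ∧ b ≡ true
true-∧ refl refl = refl

does-true : ∀ {p} {P : Set p} (P? : Dec P) → does P? ≡ true → P
does-true (yes p) _ = p

-- Only the entries G i j with i < j of a system of bipartite graphs matter.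
Graphs : ℕ → ℕ → Set
Graphs n t = Fin t → Fin t → Fin n → Fin n → Bool

Partite : Graphs n t → (Fin t → Fin n) → Set
Partite G x = ∀ i j → i Fin.< j → G i j (x i) (x j) ≡ true

-- Two partite tuples differing only at `pivot`. With at least three coordinates they share two
-- vertices, which is how they contradict edge-disjointness.
record Twins (G : Graphs n t) (Ω : Fin t → Fin n → Bool) : Set where
  field
    x x′      : Fin t → Fin n
    x∈        : ∀ i → Ω i ∋ x i
    x′∈       : ∀ i → Ω i ∋ x′ i
    partite   : Partite G x
    partite′  : Partite G x′
    pivot     : Fin t
    agree     : ∀ i → i ≢ pivot → x i ≡ x′ i
    differ    : x pivot ≢ x′ pivot

-- `1 / H` bounds the relative side lengths of the rectangle from below and `1 / M` its edge density
-- from above, with denominators cleared.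
record SparseIn (M H : ℕ) (E : Fin n → Fin n → Bool) (A B A′ B′ : Fin n → Bool) : Set where
  constructor sparse
  field
    A′⊑A      : A′ ⊑ A
    B′⊑B      : B′ ⊑ B
    A′-large  : card A ≤ H * card A′
    B′-large  : card B ≤ H * card B′
    few-edges : M * edges E A′ B′ ≤ card A′ * card B′

-- The inverse of the relative size of the sparse rectangle found when a greedy embedding fails.
shrink : ℕ → ℕ → ℕ
shrink M zero    = 1
shrink M (suc t) = M * shrink M t + suc t

consTwins : (G : Graphs n (suc t)) (Ω : Fin (suc t) → Fin n → Bool) (v : Fin n) → Ω zero ∋ v →
  Twins (λ i j → G (suc i) (suc j)) (λ j y → Ω (suc j) y ∧ G zero (suc j) v y) → Twins G Ω
consTwins {n} {t} G Ω v v∈ T = record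
  { x = cons x ; x′ = cons x′
  ; x∈ = cons∈ x∈ ; x′∈ = cons∈ x′∈
  ; partite = consPartite x∈ partite ; partite′ = consPartite x′∈ partite′
  ; pivot = suc pivot
  ; agree = λ { zero _ → refl ; (suc i) i≢ → agree i (i≢ ∘ cong suc) }
  ; differ = differ
  }
  where
  open Twins T
  cons : (Fin t → Fin n) → Fin (suc t) → Fin n
  cons z zero    = v
  cons z (suc i) = z i
  cons∈ : ∀ {z} → (∀ i → Ω (suc i) (z i) ∧ G zero (suc i) v (z i) ≡ true) → ∀ i → Ω i ∋ cons z i
  cons∈     z∈ zero    = v∈
  cons∈ {z} z∈ (suc i) = proj₁ (∧-true (Ω (suc i) (z i)) (z∈ i))
  consPartite : ∀ {z} → (∀ i → Ω (suc i) (z i) ∧ G zero (suc i) v (z i) ≡ true) →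
    Partite (λ i j → G (suc i) (suc j)) z → Partite G (cons z)
  consPartite {z} z∈ pz zero    (suc j) _         = proj₂ (∧-true (Ω (suc j) (z j)) (z∈ j))
  consPartite     z∈ pz (suc i) (suc j) (s<s i<j) = pz i j i<j

-- Induction on the number of classes. If some `v` in the first class has at least a `1 / M`
-- fraction of every later class as neighbours, recurse into its neighbourhoods; a sparse rectangle
-- found there loses another factor `M` relative to the original classes. The size `2 * M ^ t`
-- survives `t` such steps and leaves two vertices in the last class, the two values at the pivot.
greedy : ∀ M .{{_ : NonZero M}} t (G : Graphs n (suc t)) (Ω : Fin (suc t) → Fin n → Bool) →
  (∀ i → 2 * M ^ t ≤ card (Ω i)) →
  Twins G Ω ⊎ ∃₂ λ i j → i Fin.< j × ∃₂ (SparseIn M (shrink M t) (G i j) (Ω i) (Ω j))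
greedy M zero G Ω large =
  let a , b , a∈ , b∈ , a≢b = twoElements (Ω zero) (large zero) in inj₁ record
  { x = λ _ → a ; x′ = λ _ → b
  ; x∈ = λ { zero → a∈ } ; x′∈ = λ { zero → b∈ }
  ; partite = λ { zero zero () } ; partite′ = λ { zero zero () }
  ; pivot = zero
  ; agree = λ { zero 0≢0 → contradiction refl 0≢0 }
  ; differ = a≢b
  }
greedy {n} M (suc t) G Ω large
  with Fin.any? (λ v → (Ω zero v Bool.≟ true) ×-dec Fin.all? (λ j → card (Ω (suc j)) ≤? M * card (Γ v j)))
  where
  Γ : Fin n → Fin (suc t) → Fin n → Bool
  Γ v j y = Ω (suc j) y ∧ G zero (suc j) v y
... | yes (v , v∈ , rich) with greedy M t (λ i j → G (suc i) (suc j))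
        (λ j y → Ω (suc j) y ∧ G zero (suc j) v y) large′
  where
  open ≤-Reasoning
  large′ : ∀ j → 2 * M ^ t ≤ card (λ y → Ω (suc j) y ∧ G zero (suc j) v y)
  large′ j = *-cancelˡ-≤ M (begin
    M * (2 * M ^ t)    ≡⟨ *-left-comm M 2 (M ^ t) ⟩
    2 * (M * M ^ t)    ≤⟨ large (suc j) ⟩
    card (Ω (suc j))   ≤⟨ rich j ⟩
    M * card (λ y → Ω (suc j) y ∧ G zero (suc j) v y) ∎)
... | inj₁ T = inj₁ (consTwins G Ω v v∈ T)
... | inj₂ (i , j , i<j , A′ , B′ , sparse A′⊑ B′⊑ A′≥ B′≥ few) =
  inj₂ (suc i , suc j , s<s i<j , A′ , B′ , sparse
    (λ x x∈ → proj₁ (∧-true (Ω (suc i) x) (A′⊑ x x∈)))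
    (λ x x∈ → proj₁ (∧-true (Ω (suc j) x) (B′⊑ x x∈)))
    (grow (rich i) A′≥) (grow (rich j) B′≥) few)
  where
  open ≤-Reasoning
  grow : ∀ {a b c} → a ≤ M * b → b ≤ shrink M t * c → a ≤ (M * shrink M t + suc t) * c
  grow {a} {b} {c} a≤ b≤ = begin
    a                            ≤⟨ a≤ ⟩
    M * b                        ≤⟨ *-monoʳ-≤ M b≤ ⟩
    M * (shrink M t * c)         ≡⟨ *-assoc M (shrink M t) c ⟨
    M * shrink M t * c           ≤⟨ *-monoˡ-≤ c (m≤m+n (M * shrink M t) (suc t)) ⟩
    (M * shrink M t + suc t) * c ∎
-- Every vertex of the first class has too few neighbours in some later class. The class `j` blamed
-- most often gives a set `A j` holding at least a `1 / suc t` fraction of the first class; this is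
-- the summand `suc t` in `shrink`.
greedy {n} M (suc t) G Ω large | no poor =
  let j , _ , bd = ∑-averaging (allFin (suc t)) (λ j → card (A j)) (s≤s z≤n) spread
  in inj₂ (zero , suc j , s≤s z≤n , A j , Ω (suc j) , sparse
    (λ x x∈ → proj₁ (∧-true (Ω zero x) x∈))
    (λ x x∈ → x∈)
    (≤-trans bd (*-monoˡ-≤ (card (A j)) (≤-trans (≤-reflexive (length-allFin (suc t))) (m≤n+m (suc t) (M * shrink M t)))))
    (≤-trans (≤-reflexive (sym (*-identityˡ _))) (*-monoˡ-≤ (card (Ω (suc j))) (≤-trans (s≤s z≤n) (m≤n+m (suc t) (M * shrink M t)))))
    (few j))
  where
  open ≤-Reasoning
  Γ : Fin n → Fin (suc t) → Fin n → Bool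
  Γ v j y = Ω (suc j) y ∧ G zero (suc j) v y
  A : Fin (suc t) → Fin n → Bool
  A j v = Ω zero v ∧ does (M * card (Γ v j) <? card (Ω (suc j)))
  covered : ∀ v → ⟦ Ω zero v ⟧ ≤ ∑[ j < suc t ] ⟦ A j v ⟧
  covered v with Ω zero v in v∈
  ... | false = z≤n
  ... | true with Fin.¬∀⟶∃¬ (suc t) _ (λ j → card (Ω (suc j)) ≤? M * card (Γ v j)) (λ rich → poor (v , v∈ , rich))
  ... | j , ¬rich = ≤-trans (≤-reflexive (cong ⟦_⟧ (sym (dec-true (M * card (Γ v j) <? card (Ω (suc j))) (≰⇒> ¬rich)))))
          (term≤∑ (λ j → ⟦ does (M * card (Γ v j) <? card (Ω (suc j))) ⟧) (∈-allFin j))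
  spread : card (Ω zero) ≤ ∑[ j < suc t ] card (A j)
  spread = ≤-trans (∑-mono (allFin n) covered) (≤-reflexive (∑-swap (allFin n) (allFin (suc t)) (λ v j → ⟦ A j v ⟧)))
  few : ∀ j → M * edges (G zero (suc j)) (A j) (Ω (suc j)) ≤ card (A j) * card (Ω (suc j))
  few j = begin
    M * edges (G zero (suc j)) (A j) (Ω (suc j))
      ≡⟨ *-distribˡ-∑ M (allFin n) (λ v → ⟦ A j v ⟧ * card (Γ v j)) ⟩
    ∑[ v < n ] (M * (⟦ A j v ⟧ * card (Γ v j)))
      ≤⟨ ∑-mono (allFin n) bound ⟩
    ∑[ v < n ] (⟦ A j v ⟧ * card (Ω (suc j)))
      ≡⟨ *-distribʳ-∑ (card (Ω (suc j))) (allFin n) (λ v → ⟦ A j v ⟧) ⟨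
    card (A j) * card (Ω (suc j)) ∎
    where
    bound : ∀ v → M * (⟦ A j v ⟧ * card (Γ v j)) ≤ ⟦ A j v ⟧ * card (Ω (suc j))
    bound v with A j v in v∈
    ... | false = ≤-reflexive (*-zeroʳ M)
    ... | true  = ≤-trans (≤-reflexive (cong (M *_) (*-identityˡ _)))
      (≤-trans (<⇒≤ (does-true (M * card (Γ v j) <? card (Ω (suc j))) (proj₂ (∧-true (Ω zero v) v∈)))) (≤-reflexive (sym (*-identityˡ _))))

-- Areas and edge counts over the blocks of a partition

∑² : ∀ n → (Fin n → Fin n → ℕ) → ℕ
∑² n F = ∑[ x < n ] ∑[ y < n ] F x y

∑²-cong : ∀ {F F′ : Fin n → Fin n → ℕ} → (∀ x y → F x y ≡ F′ x y) → ∑² n F ≡ ∑² n F′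
∑²-cong {n} h = ∑-cong (allFin n) λ x → ∑-cong (allFin n) (h x)

∑²-mono : ∀ {F F′ : Fin n → Fin n → ℕ} → (∀ x y → F x y ≤ F′ x y) → ∑² n F ≤ ∑² n F′
∑²-mono {n} h = ∑-mono (allFin n) λ x → ∑-mono (allFin n) (h x)

∑²-distrib-+ : ∀ (F F′ : Fin n → Fin n → ℕ) → ∑² n (λ x y → F x y + F′ x y) ≡ ∑² n F + ∑² n F′
∑²-distrib-+ {n} F F′ = trans (∑-cong (allFin n) λ x → ∑-distrib-+ (allFin n) (F x) (F′ x))
  (∑-distrib-+ (allFin n) (λ x → ∑ᶠ n (F x)) (λ x → ∑ᶠ n (F′ x)))

∑²-* : ∀ c (F : Fin n → Fin n → ℕ) → c * ∑² n F ≡ ∑² n (λ x y → c * F x y)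
∑²-* {n} c F = trans (*-distribˡ-∑ c (allFin n) _) (∑-cong (allFin n) λ x → *-distribˡ-∑ c (allFin n) (F x))

∑²-≤1 : ∀ (F : Fin n → Fin n → Bool) → ∑² n (λ x y → ⟦ F x y ⟧) ≤ n * n
∑²-≤1 {n} F = ≤-trans (∑-≤-const (allFin n) λ x → ∑-≤-const (allFin n) λ y → ⟦⟧≤1 (F x y))
  (≤-reflexive (cong₂ _*_ (length-allFin n) (trans (*-identityʳ _) (length-allFin n))))

module Blocks (ℓ : Fin n → Fin k) where

  part : Fin k → Fin n → Bool
  part a x = does (ℓ x Fin.≟ a)

  ∑-parts : ∀ f → ∑ᶠ n f ≡ ∑[ a < k ] ∑[ x < n ] (⟦ part a x ⟧ * f x)
  ∑-parts f = trans (∑-cong (allFin n) λ x → sym (∑-δ (ℓ x) (f x)))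
    (∑-swap (allFin n) (allFin k) (λ x a → ⟦ part a x ⟧ * f x))

  ∑²-parts : ∀ (F : Fin n → Fin n → ℕ) → ∑² n F ≡ ∑² k λ a b → ∑² n λ x y → ⟦ part a x ⟧ * (⟦ part b y ⟧ * F x y)
  ∑²-parts F = trans (∑-parts (λ x → ∑ᶠ n (F x))) (∑-cong (allFin k) λ a →
    trans (∑-cong (allFin n) λ x →
      trans (cong (⟦ part a x ⟧ *_) (∑-parts (F x)))
      (trans (*-distribˡ-∑ ⟦ part a x ⟧ (allFin k) _)
      (∑-cong (allFin k) λ b → *-distribˡ-∑ ⟦ part a x ⟧ (allFin n) _)))
    (∑-swap (allFin n) (allFin k) _))

  ∑²-labels : ∀ (D : Fin k → Fin k → Bool) →
    ∑² n (λ x y → ⟦ D (ℓ x) (ℓ y) ⟧) ≡ ∑² k λ a b → ⟦ D a b ⟧ * (card (part a) * card (part b))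
  ∑²-labels D = trans (∑²-parts _) (∑²-cong λ a b →
    trans (∑²-cong λ x y → pointwise a b x y)
    (trans (sym (∑²-* ⟦ D a b ⟧ (λ x y → ⟦ part a x ⟧ * ⟦ part b y ⟧)))
    (cong (⟦ D a b ⟧ *_) (∑-product (allFin n) (allFin n) _ _))))
    where
    pointwise : ∀ a b x y →
      ⟦ part a x ⟧ * (⟦ part b y ⟧ * ⟦ D (ℓ x) (ℓ y) ⟧) ≡ ⟦ D a b ⟧ * (⟦ part a x ⟧ * ⟦ part b y ⟧)
    pointwise a b x y with ℓ x Fin.≟ a | ℓ y Fin.≟ b
    ... | yes refl | yes refl = trans (+-identityʳ _) (trans (+-identityʳ _) (sym (*-identityʳ _)))
    ... | yes _    | no _     = sym (*-zeroʳ ⟦ D a b ⟧)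
    ... | no _     | _        = sym (*-zeroʳ ⟦ D a b ⟧)

  module Rectangles (A B : Fin k → Fin k → Fin n → Bool)
    (A⊑ : ∀ a b → A a b ⊑ part a) (B⊑ : ∀ a b → B a b ⊑ part b) where

    -- The rectangle for `(a , b)` lies inside the block of the parts `a` and `b`. Hence the
    -- rectangles are disjoint and only the one for `(ℓ x , ℓ y)` can contain `(x , y)`; this makes
    -- areas and edge counts additive.
    union : Fin n → Fin n → Bool
    union x y = A (ℓ x) (ℓ y) x ∧ B (ℓ x) (ℓ y) y

    ∑²-union : ∀ (F : Fin n → Fin n → ℕ) → ∑² n (λ x y → ⟦ union x y ⟧ * F x y) ≡
      ∑² k λ a b → ∑² n λ x y → ⟦ A a b x ⟧ * (⟦ B a b y ⟧ * F x y)
    ∑²-union F = trans (∑²-parts _) (∑²-cong λ a b → ∑²-cong λ x y → pointwise a b x y)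
      where
      pointwise : ∀ a b x y → ⟦ part a x ⟧ * (⟦ part b y ⟧ * (⟦ union x y ⟧ * F x y)) ≡
        ⟦ A a b x ⟧ * (⟦ B a b y ⟧ * F x y)
      pointwise a b x y with ℓ x Fin.≟ a | ℓ y Fin.≟ b | A⊑ a b x | B⊑ a b y
      ... | yes refl | yes refl | _ | _ = trans (+-identityʳ _) (trans (+-identityʳ _)
            (trans (cong (_* F x y) (⟦∧⟧ (A (ℓ x) (ℓ y) x) _)) (*-assoc ⟦ A (ℓ x) (ℓ y) x ⟧ _ _)))
      ... | no _ | _ | p | _ with A a b x
      ...   | false = refl
      ...   | true  = contradiction (p refl) λ ()
      pointwise a b x y | yes _ | no _ | _ | p with B a b y
      ...   | false = sym (*-zeroʳ ⟦ A a b x ⟧)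
      ...   | true  = contradiction (p refl) λ ()

    area-union : ∑² n (λ x y → ⟦ union x y ⟧) ≡ ∑² k λ a b → card (A a b) * card (B a b)
    area-union = trans (∑²-cong λ x y → sym (*-identityʳ ⟦ union x y ⟧))
      (trans (∑²-union (λ _ _ → 1)) (∑²-cong λ a b →
        trans (∑²-cong λ x y → cong (⟦ A a b x ⟧ *_) (*-identityʳ ⟦ B a b y ⟧))
        (∑-product (allFin n) (allFin n) _ _)))

    edges-union : ∀ (E : Fin n → Fin n → Bool) → ∑² n (λ x y → ⟦ union x y ∧ E x y ⟧) ≡ ∑² k λ a b → edges E (A a b) (B a b)
    edges-union E = trans (∑²-cong λ x y → ⟦∧⟧ (union x y) (E x y))
      (trans (∑²-union (λ x y → ⟦ E x y ⟧)) (∑²-cong λ a b → ∑-cong (allFin n) λ x →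
        trans (sym (*-distribˡ-∑ ⟦ A a b x ⟧ (allFin n) _))
        (cong (⟦ A a b x ⟧ *_) (∑-cong (allFin n) λ y → sym (⟦∧⟧ (B a b y) (E x y))))))

    union-few : ∀ M E → (∀ a b → M * edges E (A a b) (B a b) ≤ card (A a b) * card (B a b)) →
      M * ∑² n (λ x y → ⟦ union x y ∧ E x y ⟧) ≤ ∑² n (λ x y → ⟦ union x y ⟧)
    union-few M E few = begin
      M * ∑² n (λ x y → ⟦ union x y ∧ E x y ⟧)        ≡⟨ cong (M *_) (edges-union E) ⟩
      M * ∑² k (λ a b → edges E (A a b) (B a b))      ≡⟨ ∑²-* {k} M (λ a b → edges E (A a b) (B a b)) ⟩
      ∑² k (λ a b → M * edges E (A a b) (B a b))      ≤⟨ ∑²-mono few ⟩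
      ∑² k (λ a b → card (A a b) * card (B a b))      ≡⟨ area-union ⟨
      ∑² n (λ x y → ⟦ union x y ⟧)                    ∎
      where open ≤-Reasoning

    union-large : ∀ H (D : Fin k → Fin k → Bool) →
      (∀ a b → D a b ≡ true → card (part a) ≤ H * card (A a b) × card (part b) ≤ H * card (B a b)) →
      ∑² n (λ x y → ⟦ D (ℓ x) (ℓ y) ⟧) ≤ H * H * ∑² n (λ x y → ⟦ union x y ⟧)
    union-large H D large = begin
      ∑² n (λ x y → ⟦ D (ℓ x) (ℓ y) ⟧)                           ≡⟨ ∑²-labels D ⟩
      ∑² k (λ a b → ⟦ D a b ⟧ * (card (part a) * card (part b))) ≤⟨ ∑²-mono bound ⟩
      ∑² k (λ a b → H * H * (card (A a b) * card (B a b)))       ≡⟨ ∑²-* {k} (H * H) (λ a b → card (A a b) * card (B a b)) ⟨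
      H * H * ∑² k (λ a b → card (A a b) * card (B a b))         ≡⟨ cong (H * H *_) area-union ⟨
      H * H * ∑² n (λ x y → ⟦ union x y ⟧)                       ∎
      where
      open ≤-Reasoning
      bound : ∀ a b → ⟦ D a b ⟧ * (card (part a) * card (part b)) ≤ H * H * (card (A a b) * card (B a b))
      bound a b with D a b in eq
      ... | false = z≤n
      ... | true  = ≤-trans (≤-reflexive (*-identityˡ _))
        (≤-trans (*-mono-≤ (proj₁ (large a b eq)) (proj₂ (large a b eq)))
          (≤-reflexive (*-interchange H (card (A a b)) H (card (B a b)))))

  -- There are `k` parts, and each contributes either nothing or fewer than `s` vertices.
  small-parts : ∀ s → ∑[ x < n ] ⟦ does (card (part (ℓ x)) <? s) ⟧ ≤ k * s
  small-parts s = begin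
    ∑[ x < n ] ⟦ does (card (part (ℓ x)) <? s) ⟧ ≡⟨ ∑-parts _ ⟩
    ∑[ a < k ] ∑[ x < n ] (⟦ part a x ⟧ * ⟦ does (card (part (ℓ x)) <? s) ⟧) ≤⟨ ∑-≤-const (allFin k) bound ⟩
    length (allFin k) * s ≡⟨ cong (_* s) (length-allFin k) ⟩
    k * s ∎
    where
    open ≤-Reasoning
    pointwise : ∀ a x → ⟦ part a x ⟧ * ⟦ does (card (part (ℓ x)) <? s) ⟧ ≡ ⟦ part a x ⟧ * ⟦ does (card (part a) <? s) ⟧
    pointwise a x with ℓ x Fin.≟ a
    ... | yes refl = refl
    ... | no _     = refl
    truncate : ∀ m (m<s? : Dec (m < s)) → m * ⟦ does m<s? ⟧ ≤ s
    truncate m (yes m<s) = ≤-trans (≤-reflexive (*-identityʳ m)) (<⇒≤ m<s)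
    truncate m (no _)    = ≤-trans (≤-reflexive (*-zeroʳ m)) z≤n
    bound : ∀ a → ∑[ x < n ] (⟦ part a x ⟧ * ⟦ does (card (part (ℓ x)) <? s) ⟧) ≤ s
    bound a = ≤-trans (≤-reflexive (trans (∑-cong (allFin n) (pointwise a)) (sym (*-distribʳ-∑ _ (allFin n) _))))
      (truncate (card (part a)) (card (part a) <? s))

-- Finite codes for the labels of a refined partition

module Table (t k : ℕ) where

  tables : ℕ
  tables = ((2 ^ k) ^ t) ^ t

  bit : Bool → Fin 2
  bit true  = suc zero
  bit false = zero

  unbit : Fin 2 → Bool
  unbit zero    = false
  unbit (suc _) = true

  unbit-bit : ∀ b → unbit (bit b) ≡ b
  unbit-bit true  = refl
  unbit-bit false = refl

  write : (Fin t → Fin t → Fin k → Bool) → Fin tables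
  write f = funToFin λ i → funToFin λ j → funToFin λ a → bit (f i j a)

  read : Fin tables → Fin t → Fin t → Fin k → Bool
  read c i j a = unbit (finToFun (finToFun {2 ^ k} {t} (finToFun {(2 ^ k) ^ t} {t} c i) j) a)

  read-write : ∀ f i j a → read (write f) i j a ≡ f i j a
  read-write f i j a
    rewrite Fin.finToFun-funToFin (λ i → funToFin λ j → funToFin λ a → bit (f i j a)) i
          | Fin.finToFun-funToFin (λ j → funToFin λ a → bit (f i j a)) j
          | Fin.finToFun-funToFin (λ a → bit (f i j a)) a = unbit-bit (f i j a)

  -- The number of labels after one refinement. It depends on `t` and `k` but not on `n`, which
  -- keeps the number of parts bounded over boundedly many rounds.
  relabel : ℕ
  relabel = k * (tables * tables)

  Entries : Set
  Entries = Fin t → Fin t → Fin k → Bool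

  abstract
    -- A new label consists of the old label and two tables: for every `(i , j)` and every label of
    -- the opposite part, whether the vertex lies in the left, respectively right, side of the
    -- rectangle chosen there.
    pack : Fin k → Entries → Entries → Fin relabel
    pack a f g = combine a (combine (write f) (write g))

    label : Fin relabel → Fin k
    label c = proj₁ (remQuot {k} (tables * tables) c)

    left right : Fin relabel → Entries
    left  c = read (proj₁ (remQuot {tables} tables (proj₂ (remQuot {k} (tables * tables) c))))
    right c = read (proj₂ (remQuot {tables} tables (proj₂ (remQuot {k} (tables * tables) c))))

    label-pack : ∀ a f g → label (pack a f g) ≡ a
    label-pack a f g = cong proj₁ (Fin.remQuot-combine a (combine (write f) (write g)))

    unpack : ∀ a f g → remQuot {tables} tables (proj₂ (remQuot {k} (tables * tables) (pack a f g))) ≡ (write f , write g)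
    unpack a f g = trans (cong (remQuot {tables} tables ∘ proj₂) (Fin.remQuot-combine a (combine (write f) (write g))))
      (Fin.remQuot-combine (write f) (write g))

    left-pack : ∀ a f g i j b → left (pack a f g) i j b ≡ f i j b
    left-pack a f g i j b = trans (cong (λ p → read (proj₁ p) i j b) (unpack a f g)) (read-write f i j b)

    right-pack : ∀ a f g i j b → right (pack a f g) i j b ≡ g i j b
    right-pack a f g i j b = trans (cong (λ p → read (proj₂ p) i j b) (unpack a f g)) (read-write g i j b)

SparseIn? : ∀ M H (E : Fin n → Fin n → Bool) A B A′ B′ → Dec (SparseIn M H E A B A′ B′)
SparseIn? M H E A B A′ B′ = map′
  (λ (p , q , r , s , u) → sparse p q r s u)
  (λ (sparse p q r s u) → p , q , r , s , u)
  (A′ ⊑? A ×-dec B′ ⊑? B ×-dec (_ ≤? _) ×-dec (_ ≤? _) ×-dec (_ ≤? _))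
  where
  infix 5 _⊑?_
  _⊑?_ : ∀ A B → Dec (A ⊑ B)
  A ⊑? B = Fin.all? λ x → (A x Bool.≟ true) →-dec (B x Bool.≟ true)

-- The sides are bit vectors rather than Boolean functions, so that existence can be decided by
-- searching through all subsets.
HasSparse : ∀ M H (E : Fin n → Fin n → Bool) (A B : Fin n → Bool) → Set
HasSparse {n} M H E A B =
  ∃ λ (A′ : Sub.Subset n) → ∃ λ (B′ : Sub.Subset n) → SparseIn M H E A B (Vec.lookup A′) (Vec.lookup B′)

abstract
  hasSparse? : ∀ M H (E : Fin n → Fin n → Bool) A B → Dec (HasSparse M H E A B)
  hasSparse? M H E A B = Sub.anySubset? λ A′ → Sub.anySubset? λ B′ →
    SparseIn? M H E A B (Vec.lookup A′) (Vec.lookup B′)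

card-cong : ∀ {A B : Fin n → Bool} → (∀ x → A x ≡ B x) → card A ≡ card B
card-cong {n} h = ∑-cong (allFin n) (cong ⟦_⟧ ∘ h)

sparse⇒hasSparse : ∀ {M H} {E : Fin n → Fin n → Bool} {A B A′ B′} → SparseIn M H E A B A′ B′ → HasSparse M H E A B
sparse⇒hasSparse {n} {M} {H} {E} {A′ = A′} {B′} (sparse A′⊑ B′⊑ A′≥ B′≥ few) =
  Vec.tabulate A′ , Vec.tabulate B′ , sparse
    (λ x x∈ → A′⊑ x (trans (sym (Vec.lookup∘tabulate A′ x)) x∈))
    (λ x x∈ → B′⊑ x (trans (sym (Vec.lookup∘tabulate B′ x)) x∈))
    (subst (λ m → _ ≤ H * m) (sym cardA) A′≥)
    (subst (λ m → _ ≤ H * m) (sym cardB) B′≥)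
    (subst₂ (λ e m → M * e ≤ m) (sym edgesE) (sym (cong₂ _*_ cardA cardB)) few)
  where
  cardA = card-cong (Vec.lookup∘tabulate A′)
  cardB = card-cong (Vec.lookup∘tabulate B′)
  edgesE : edges E (Vec.lookup (Vec.tabulate A′)) (Vec.lookup (Vec.tabulate B′)) ≡ edges E A′ B′
  edgesE = ∑-cong (allFin n) λ x → cong₂ (λ a m → ⟦ a ⟧ * m) (Vec.lookup∘tabulate A′ x)
    (card-cong λ y → cong (_∧ E x y) (Vec.lookup∘tabulate B′ y))

-- One round: new sparse rectangles and the refined partition

open Table using (relabel)

module _ (M H : ℕ) (G : Graphs n t) where

  -- S i j marks the pairs of labels whose blocks have been found to be sparse in G i j.
  record State (k : ℕ) : Set where
    field
      ℓ   : Fin n → Fin k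
      S   : Fin t → Fin t → Fin k → Fin k → Bool
      few : ∀ i j → M * ∑² n (λ x y → ⟦ S i j (ℓ x) (ℓ y) ∧ G i j x y ⟧) ≤
                    ∑² n (λ x y → ⟦ S i j (ℓ x) (ℓ y) ⟧)

    marked : Fin t → Fin t → ℕ
    marked i j = ∑² n λ x y → ⟦ S i j (ℓ x) (ℓ y) ⟧

  initial : State 1
  initial = record
    { ℓ = λ _ → zero ; S = λ _ _ _ _ → false
    ; few = λ i j → ≤-trans (≤-reflexive (cong (M *_) (∑²-zero))) (≤-trans (≤-reflexive (*-zeroʳ M)) z≤n) }
    where
    ∑²-zero : ∑² n (λ _ _ → 0) ≡ 0
    ∑²-zero = trans (∑-cong (allFin n) λ _ → ∑-zero (allFin n)) (∑-zero (allFin n))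

  module Refine {k : ℕ} (σ : State k) where
    open State σ
    open Blocks ℓ

    -- Rectangles are taken only in unmarked blocks, so the new area is disjoint from the marked one
    -- and the two add up.
    Fresh : Fin t → Fin t → Fin k → Fin k → Set
    Fresh i j a b = S i j a b ≡ false × HasSparse M H (G i j) (part a) (part b)

    fresh? : ∀ i j a b → Dec (Fresh i j a b)
    fresh? i j a b = (S i j a b Bool.≟ false) ×-dec hasSparse? M H (G i j) (part a) (part b)

    module _ {i j : Fin t} {a b : Fin k} where

      left right : Dec (Fresh i j a b) → Fin n → Bool
      left  (yes (_ , A′ , _))     = Vec.lookup A′
      left  (no _)                 = λ _ → false
      right (yes (_ , _ , B′ , _)) = Vec.lookup B′
      right (no _)                 = λ _ → false

      left⊑ : ∀ d → left d ⊑ part a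
      left⊑ (yes (_ , _ , _ , sp)) = SparseIn.A′⊑A sp

      right⊑ : ∀ d → right d ⊑ part b
      right⊑ (yes (_ , _ , _ , sp)) = SparseIn.B′⊑B sp

      rectangle-few : ∀ d → M * edges (G i j) (left d) (right d) ≤ card (left d) * card (right d)
      rectangle-few (yes (_ , _ , _ , sp)) = SparseIn.few-edges sp
      rectangle-few (no _) = ≤-trans (≤-reflexive (trans (cong (M *_) (∑-zero (allFin n))) (*-zeroʳ M))) z≤n

      rectangle-large : ∀ d → does d ≡ true →
        card (part a) ≤ H * card (left d) × card (part b) ≤ H * card (right d)
      rectangle-large (yes (_ , _ , _ , sp)) _ = SparseIn.A′-large sp , SparseIn.B′-large sp

      left-disjoint : ∀ d x → S i j a b ∧ left d x ≡ false
      left-disjoint (yes (eq , _)) x rewrite eq = refl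
      left-disjoint (no _)         x = Bool.∧-zeroʳ (S i j a b)

    A B : Fin t → Fin t → Fin k → Fin k → Fin n → Bool
    A i j a b = left (fresh? i j a b)
    B i j a b = right (fresh? i j a b)

    module R (i j : Fin t) = Rectangles (A i j) (B i j) (λ a b → left⊑ (fresh? i j a b)) (λ a b → right⊑ (fresh? i j a b))

    new : Fin t → Fin t → Fin n → Fin n → Bool
    new = R.union

    gain : Fin t → Fin t → ℕ
    gain i j = ∑² n λ x y → ⟦ new i j x y ⟧

    ℓ′ : Fin n → Fin (relabel t k)
    ℓ′ x = Table.pack t k (ℓ x) (λ i j b → A i j (ℓ x) b x) (λ i j a → B i j a (ℓ x) x)

    -- Membership in a new rectangle is read off the tables stored in the two labels. So every new
    -- rectangle is a union of blocks of the refined partition, and marking it is a condition on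
    -- labels alone.
    S′ : Fin t → Fin t → Fin (relabel t k) → Fin (relabel t k) → Bool
    S′ i j c d = S i j (label c) (label d) ∨ (Table.left t k c i j (label d) ∧ Table.right t k d i j (label c))
      where open Table t k using (label)

    S′-ℓ′ : ∀ i j x y → S′ i j (ℓ′ x) (ℓ′ y) ≡ S i j (ℓ x) (ℓ y) ∨ new i j x y
    S′-ℓ′ i j x y = cong₂ _∨_
      (cong₂ (S i j) (Table.label-pack t k _ _ _) (Table.label-pack t k _ _ _))
      (cong₂ _∧_
        (trans (Table.left-pack t k _ _ _ i j _) (cong (λ b → A i j (ℓ x) b x) (Table.label-pack t k _ _ _)))
        (trans (Table.right-pack t k _ _ _ i j _) (cong (λ a → B i j a (ℓ y) y) (Table.label-pack t k _ _ _))))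

    disjoint : ∀ i j x y → S i j (ℓ x) (ℓ y) ∧ new i j x y ≡ false
    disjoint i j x y = trans (sym (Bool.∧-assoc (S i j (ℓ x) (ℓ y)) _ _))
      (cong (_∧ B i j (ℓ x) (ℓ y) y) (left-disjoint (fresh? i j (ℓ x) (ℓ y)) x))

    ⟦∨⟧ : ∀ a b c → a ∧ b ≡ false → ⟦ (a ∨ b) ∧ c ⟧ ≡ ⟦ a ∧ c ⟧ + ⟦ b ∧ c ⟧
    ⟦∨⟧ true  false c _ = sym (+-identityʳ ⟦ c ⟧)
    ⟦∨⟧ false b     c _ = refl

    ∑²-S′ : ∀ i j (E : Fin n → Fin n → Bool) → ∑² n (λ x y → ⟦ S′ i j (ℓ′ x) (ℓ′ y) ∧ E x y ⟧) ≡
      ∑² n (λ x y → ⟦ S i j (ℓ x) (ℓ y) ∧ E x y ⟧) + ∑² n (λ x y → ⟦ new i j x y ∧ E x y ⟧)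
    ∑²-S′ i j E = trans
      (∑²-cong λ x y → trans (cong (λ s → ⟦ s ∧ E x y ⟧) (S′-ℓ′ i j x y))
        (⟦∨⟧ (S i j (ℓ x) (ℓ y)) (new i j x y) (E x y) (disjoint i j x y)))
      (∑²-distrib-+ (λ x y → ⟦ S i j (ℓ x) (ℓ y) ∧ E x y ⟧) (λ x y → ⟦ new i j x y ∧ E x y ⟧))

    ∧-true-area : ∀ (F : Fin n → Fin n → Bool) → ∑² n (λ x y → ⟦ F x y ∧ true ⟧) ≡ ∑² n (λ x y → ⟦ F x y ⟧)
    ∧-true-area F = ∑²-cong λ x y → cong ⟦_⟧ (Bool.∧-identityʳ (F x y))

    marked′ : ∀ i j → ∑² n (λ x y → ⟦ S′ i j (ℓ′ x) (ℓ′ y) ⟧) ≡ marked i j + gain i j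
    marked′ i j = trans (sym (∧-true-area λ x y → S′ i j (ℓ′ x) (ℓ′ y))) (trans (∑²-S′ i j (λ _ _ → true))
      (cong₂ _+_ (∧-true-area λ x y → S i j (ℓ x) (ℓ y)) (∧-true-area (new i j))))

    -- The invariant `few` compares edges and area in total over all marked blocks, so it adds over
    -- the disjoint old and new areas.
    refined : State (relabel t k)
    refined = record { ℓ = ℓ′ ; S = S′ ; few = few′ }
      where
      open ≤-Reasoning
      few′ : ∀ i j → M * ∑² n (λ x y → ⟦ S′ i j (ℓ′ x) (ℓ′ y) ∧ G i j x y ⟧) ≤
                     ∑² n (λ x y → ⟦ S′ i j (ℓ′ x) (ℓ′ y) ⟧)
      few′ i j = begin
        M * ∑² n (λ x y → ⟦ S′ i j (ℓ′ x) (ℓ′ y) ∧ G i j x y ⟧)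
          ≡⟨ cong (M *_) (∑²-S′ i j (G i j)) ⟩
        M * (∑² n (λ x y → ⟦ S i j (ℓ x) (ℓ y) ∧ G i j x y ⟧) + ∑² n (λ x y → ⟦ new i j x y ∧ G i j x y ⟧))
          ≡⟨ *-distribˡ-+ M _ _ ⟩
        M * ∑² n (λ x y → ⟦ S i j (ℓ x) (ℓ y) ∧ G i j x y ⟧) + M * ∑² n (λ x y → ⟦ new i j x y ∧ G i j x y ⟧)
          ≤⟨ +-mono-≤ (few i j) (R.union-few i j M (G i j) λ a b → rectangle-few (fresh? i j a b)) ⟩
        marked i j + gain i j
          ≡⟨ marked′ i j ⟨
        ∑² n (λ x y → ⟦ S′ i j (ℓ′ x) (ℓ′ y) ⟧) ∎

    -- A rectangle is declared in every fresh block and fills at least `1 / (H * H)` of it. So many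
    -- cliques in fresh blocks force a large gain.
    fresh-≤-gain : ∀ i j → ∑² n (λ x y → ⟦ does (fresh? i j (ℓ x) (ℓ y)) ⟧) ≤ H * H * gain i j
    fresh-≤-gain i j = R.union-large i j H (λ a b → does (fresh? i j a b)) λ a b → rectangle-large (fresh? i j a b)

-- Iterating the refinement until the sparse area would exceed its maximum

abstract
  orderedPairs : ∀ t → List (Fin t × Fin t)
  orderedPairs t = filter (λ (i , j) → i Fin.<? j) (cartesianProduct (allFin t) (allFin t))

  ∈-orderedPairs⁺ : ∀ {i j : Fin t} → i Fin.< j → (i , j) ∈ orderedPairs t
  ∈-orderedPairs⁺ {i = i} {j} = ∈-filter⁺ (λ (i , j) → i Fin.<? j) (∈-cartesianProduct⁺ (∈-allFin i) (∈-allFin j))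

  ∈-orderedPairs⁻ : ∀ {p : Fin t × Fin t} → p ∈ orderedPairs t → proj₁ p Fin.< proj₂ p
  ∈-orderedPairs⁻ {t} p∈ = proj₂ (∈-filter⁻ (λ (i , j) → i Fin.<? j) {xs = cartesianProduct (allFin t) (allFin t)} p∈)

1≤length-orderedPairs : ∀ u → 1 ≤ length (orderedPairs (2 + u))
1≤length-orderedPairs u = ∈-length (∈-orderedPairs⁺ {i = zero} {j = suc zero} z<s)

labels : ℕ → ℕ → ℕ
labels t zero    = 1
labels t (suc r) = relabel t (labels t r)

-- Written as a sum, so that `threshold M u R ≤ n` implies the requirement of every round below `R`.
-- The summand for round `r` ensures that tuples meeting a part of size below `2 * M ^ suc u` number
-- at most `n * n / M`.
threshold : ℕ → ℕ → ℕ → ℕ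
threshold M u zero    = 0
threshold M u (suc r) = threshold M u r + M * ((2 + u) * (labels (2 + u) r * (2 * M ^ suc u)))

module _ {n u : ℕ} (G : Graphs n (2 + u)) (no-twins : ¬ Twins G (λ _ _ → true))
  {X : Set} {W : List X} (w : X → Fin (2 + u) → Fin n)
  (W-unique : Unique W) (W-partite : ∀ {a} → a ∈ W → Partite G (w a))
  (W-linear : ∀ {a b} → a ∈ W → b ∈ W → ∀ i j → i Fin.< j → w a i ≡ w b i → w a j ≡ w b j → a ≡ b)
  (M : ℕ) .{{_ : NonZero M}}
  where

  private
    H s : ℕ
    H = shrink M (suc u)
    s = 2 * M ^ suc u
    P = orderedPairs (2 + u)

  -- By `W-linear`, a tuple is determined by its vertices at two positions, so sending `a` to
  -- `(w a i , w a j)` is injective on `W`.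
  ∑-W≤∑² : ∀ i j → i ≢ j → (F : Fin n → Fin n → ℕ) → ∑[ a ∈ W ] F (w a i) (w a j) ≤ ∑² n F
  ∑-W≤∑² i j i≢j F = ≤-trans
    (∑-injective-≤ {ys = cartesianProduct (allFin n) (allFin n)} (λ a → w a i , w a j) (λ (x , y) → F x y)
      inj (λ {a} _ → ∈-cartesianProduct⁺ (∈-allFin (w a i)) (∈-allFin (w a j))) W-unique)
    (≤-reflexive (∑-× (allFin n) (allFin n) (λ (x , y) → F x y)))
    where
    inj : ∀ {a b} → a ∈ W → b ∈ W → (w a i , w a j) ≡ (w b i , w b j) → a ≡ b
    inj a∈ b∈ eq with Fin.<-cmp i j
    ... | tri< i<j _ _ = W-linear a∈ b∈ i j i<j (cong proj₁ eq) (cong proj₂ eq)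
    ... | tri≈ _ i≡j _ = contradiction i≡j i≢j
    ... | tri> _ _ j<i = W-linear a∈ b∈ j i j<i (cong proj₂ eq) (cong proj₁ eq)

  module Round {k : ℕ} (σ : State M H G k) where
    open State σ
    open Blocks ℓ
    open Refine M H G σ

    small : Fin n → ℕ
    small x = ⟦ does (card (part (ℓ x)) <? s) ⟧

    E Sm F : X → ℕ
    E a  = ∑[ (i , j) ∈ P ] ⟦ S i j (ℓ (w a i)) (ℓ (w a j)) ∧ G i j (w a i) (w a j) ⟧
    Sm a = ∑[ i < 2 + u ] small (w a i)
    F a  = ∑[ (i , j) ∈ P ] ⟦ does (fresh? i j (ℓ (w a i)) (ℓ (w a j))) ⟧

    -- If none of the parts of the tuple is small, `greedy` applied to these parts cannot give
    -- twins, so it gives a sparse rectangle in some pair of parts. That pair is either already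
    -- marked, and then the tuple's own edge there is one of the few marked edges, or it is fresh.
    covered : ∀ {a} → a ∈ W → 1 ≤ E a + (Sm a + F a)
    covered {a} a∈ with Fin.any? (λ i → card (part (ℓ (w a i))) <? s)
    ... | yes (i , i-small) = m≤n⇒m≤o+n (E a) (m≤n⇒m≤n+o (F a) (≤-trans
      (≤-reflexive (cong ⟦_⟧ (sym (dec-true (card (part (ℓ (w a i))) <? s) i-small))))
      (term≤∑ (λ i → small (w a i)) (∈-allFin i))))
    ... | no ¬small with greedy M (suc u) G (λ i → part (ℓ (w a i))) (λ i → ≮⇒≥ (λ lt → ¬small (i , lt)))
    ... | inj₁ T = contradiction (record
            { x = x ; x′ = x′ ; x∈ = λ _ → refl ; x′∈ = λ _ → refl ; partite = partite ; partite′ = partite′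
            ; pivot = pivot ; agree = agree ; differ = differ }) no-twins
      where open Twins T
    ... | inj₂ (i , j , i<j , A′ , B′ , sp) with S i j (ℓ (w a i)) (ℓ (w a j)) in eq
    ... | true  = m≤n⇒m≤n+o (Sm a + F a) (≤-trans
      (≤-reflexive (cong ⟦_⟧ (sym (true-∧ eq (W-partite a∈ i j i<j)))))
      (term≤∑ (λ (i , j) → ⟦ S i j (ℓ (w a i)) (ℓ (w a j)) ∧ G i j (w a i) (w a j) ⟧) (∈-orderedPairs⁺ i<j)))
    ... | false = m≤n⇒m≤o+n (E a) (m≤n⇒m≤o+n (Sm a) (≤-trans
      (≤-reflexive (cong ⟦_⟧ (sym (dec-true (fresh? i j (ℓ (w a i)) (ℓ (w a j))) (eq , sparse⇒hasSparse sp)))))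
      (term≤∑ (λ (i , j) → ⟦ does (fresh? i j (ℓ (w a i)) (ℓ (w a j))) ⟧) (∈-orderedPairs⁺ i<j))))

    ∑-pairs : ∀ (F : Fin (2 + u) → Fin (2 + u) → Fin n → Fin n → ℕ) →
      ∑[ a ∈ W ] ∑[ (i , j) ∈ P ] F i j (w a i) (w a j) ≤ ∑[ (i , j) ∈ P ] ∑² n (F i j)
    ∑-pairs F = ≤-trans (≤-reflexive (∑-swap W P (λ a (i , j) → F i j (w a i) (w a j))))
      (∑-mono∈ P λ { {i , j} p∈ → ∑-W≤∑² i j (Fin.<⇒≢ (∈-orderedPairs⁻ p∈)) (F i j) })

    partner : (i : Fin (2 + u)) → ∃ (i ≢_)
    partner zero    = suc zero , λ ()
    partner (suc i) = zero , λ ()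

    -- A vertex lies at a given position of at most `n` tuples, because together with the vertex at
    -- a second position, here the one given by `partner`, it determines the tuple.
    ∑-small : ∑[ a ∈ W ] ∑[ i < 2 + u ] small (w a i) ≤ (2 + u) * (k * s * n)
    ∑-small = begin
      ∑[ a ∈ W ] ∑[ i < 2 + u ] small (w a i)
        ≡⟨ ∑-swap W (allFin (2 + u)) _ ⟩
      ∑[ i < 2 + u ] ∑[ a ∈ W ] small (w a i)
        ≤⟨ ∑-mono (allFin (2 + u)) (λ i → ∑-W≤∑² i (proj₁ (partner i)) (proj₂ (partner i)) (λ x _ → small x)) ⟩
      ∑[ i < 2 + u ] ∑² n (λ x _ → small x)
        ≡⟨ trans (∑-const (allFin (2 + u)) (∑² n (λ x _ → small x))) (cong (_* ∑² n (λ x _ → small x)) (length-allFin (2 + u))) ⟩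
      (2 + u) * ∑² n (λ x _ → small x)
        ≤⟨ *-monoʳ-≤ (2 + u) bound ⟩
      (2 + u) * (k * s * n) ∎
      where
      open ≤-Reasoning
      bound : ∑² n (λ x _ → small x) ≤ k * s * n
      bound = begin
        ∑² n (λ x _ → small x)        ≡⟨ ∑-cong (allFin n) (λ x → trans (∑-const (allFin n) (small x)) (cong (_* small x) (length-allFin n))) ⟩
        ∑[ x < n ] (n * small x)      ≡⟨ *-distribˡ-∑ n (allFin n) small ⟨
        n * ∑ᶠ n small                ≤⟨ *-monoʳ-≤ n (small-parts s) ⟩
        n * (k * s)                   ≡⟨ *-comm n (k * s) ⟩
        k * s * n                     ∎

    totalGain totalMarked : ℕ
    totalGain   = ∑[ (i , j) ∈ P ] gain i j
    totalMarked = ∑[ (i , j) ∈ P ] marked i j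

    totalEdges : ℕ
    totalEdges = ∑[ (i , j) ∈ P ] ∑² n (λ x y → ⟦ S i j (ℓ x) (ℓ y) ∧ G i j x y ⟧)

    length-W : length W ≤ totalEdges + ((2 + u) * (k * s * n) + H * H * totalGain)
    length-W = begin
      length W ≡⟨ ∑-one W ⟨
      ∑[ _ ∈ W ] 1 ≤⟨ ∑-mono∈ W covered ⟩
      ∑[ a ∈ W ] (E a + (Sm a + F a)) ≡⟨ ∑-distrib-+ W E (λ a → Sm a + F a) ⟩
      ∑ W E + ∑[ a ∈ W ] (Sm a + F a) ≡⟨ cong (∑ W E +_) (∑-distrib-+ W Sm F) ⟩
      ∑ W E + (∑ W Sm + ∑ W F) ≤⟨ +-mono-≤ (∑-pairs (λ i j x y → ⟦ S i j (ℓ x) (ℓ y) ∧ G i j x y ⟧))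
          (+-mono-≤ ∑-small (∑-pairs (λ i j x y → ⟦ does (fresh? i j (ℓ x) (ℓ y)) ⟧))) ⟩
      totalEdges + ((2 + u) * (k * s * n) + ∑[ (i , j) ∈ P ] ∑² n (λ x y → ⟦ does (fresh? i j (ℓ x) (ℓ y)) ⟧))
        ≤⟨ +-monoʳ-≤ totalEdges (+-monoʳ-≤ ((2 + u) * (k * s * n)) (≤-trans (∑-mono P λ (i , j) → fresh-≤-gain i j)
             (≤-reflexive (sym (*-distribˡ-∑ (H * H) P λ (i , j) → gain i j))))) ⟩
      totalEdges + ((2 + u) * (k * s * n) + H * H * totalGain) ∎
      where open ≤-Reasoning

    totalMarked≤ : totalMarked ≤ length P * (n * n)
    totalMarked≤ = ∑-≤-const P λ (i , j) → ∑²-≤1 λ x y → S i j (ℓ x) (ℓ y)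

    totalEdges≤ : M * totalEdges ≤ length P * (n * n)
    totalEdges≤ = ≤-trans (≤-reflexive (*-distribˡ-∑ M P _)) (≤-trans (∑-mono P λ (i , j) → few i j) totalMarked≤)

    -- With `c` pairs `i < j` and `M ≡ 4 * q * c`, the density assumption makes `M * length W` at
    -- least `4 * c * (n * n)`. Marked edges and small parts account for at most `c * (n * n)` of
    -- this each, so at least `2 * c * (n * n)` is left for the gain.
    progress : ∀ q → M ≡ 4 * q * length P → 1 ≤ length P → n * n < q * length W →
      M * ((2 + u) * (k * s)) ≤ n → n * n ≤ M * (H * H) * totalGain
    progress q M≡ 1≤c dense n-large = begin
      n * n                            ≡⟨ *-identityˡ (n * n) ⟨
      1 * (n * n)                      ≤⟨ *-monoˡ-≤ (n * n) (≤-trans 1≤c (m≤n*m c 2)) ⟩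
      2 * c * (n * n)                  ≤⟨ +-cancelˡ-≤ (2 * c * (n * n)) _ _ main ⟩
      M * (H * H) * totalGain          ∎
      where
      open ≤-Reasoning
      c = length P
      main : 2 * c * (n * n) + 2 * c * (n * n) ≤ 2 * c * (n * n) + M * (H * H) * totalGain
      main = begin
        2 * c * (n * n) + 2 * c * (n * n) ≡⟨ eq₁ c (n * n) ⟩
        4 * c * (n * n)                   ≤⟨ *-monoʳ-≤ (4 * c) (<⇒≤ dense) ⟩
        4 * c * (q * length W)            ≡⟨ eq₂ c q (length W) ⟩
        4 * q * c * length W              ≡⟨ cong (_* length W) M≡ ⟨
        M * length W                      ≤⟨ *-monoʳ-≤ M length-W ⟩
        M * (totalEdges + ((2 + u) * (k * s * n) + H * H * totalGain)) ≡⟨ eq₃ M totalEdges (2 + u) (k * s) n (H * H) totalGain ⟩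
        M * totalEdges + (M * ((2 + u) * (k * s)) * n) + M * (H * H) * totalGain
          ≤⟨ +-monoˡ-≤ (M * (H * H) * totalGain) (+-mono-≤ totalEdges≤ (≤-trans (*-monoˡ-≤ n n-large)
               (≤-trans (≤-reflexive (sym (*-identityˡ (n * n)))) (*-monoˡ-≤ (n * n) 1≤c)))) ⟩
        c * (n * n) + c * (n * n) + M * (H * H) * totalGain ≡⟨ cong (_+ M * (H * H) * totalGain) (eq₄ c (n * n)) ⟩
        2 * c * (n * n) + M * (H * H) * totalGain ∎
        where
        eq₁ : ∀ c m → 2 * c * m + 2 * c * m ≡ 4 * c * m
        eq₁ = solve-∀
        eq₂ : ∀ c q l → 4 * c * (q * l) ≡ 4 * q * c * l
        eq₂ = solve-∀
        eq₃ : ∀ M e v ks n h g → M * (e + (v * (ks * n) + h * g)) ≡ M * e + M * (v * ks) * n + M * h * g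
        eq₃ = solve-∀
        eq₄ : ∀ c m → c * m + c * m ≡ 2 * c * m
        eq₄ = solve-∀

  module _ (q : ℕ) (M≡ : M ≡ 4 * q * length P) (1≤c : 1 ≤ length P) (dense : n * n < q * length W) where

    -- Each round adds at least `n * n / (M * (H * H))` to the marked area summed over all pairs.
    rounds : ∀ r → threshold M u r ≤ n →
      ∃ λ (σ : State M H G (labels (2 + u) r)) → r * (n * n) ≤ M * (H * H) * Round.totalMarked σ
    rounds zero    _       = initial M H G , z≤n
    rounds (suc r) n-large with rounds r (m+n≤o⇒m≤o (threshold M u r) n-large)
    ... | σ , marked≥ = refined , (begin
      n * n + r * (n * n)
        ≤⟨ +-mono-≤ (progress q M≡ 1≤c dense (m+n≤o⇒n≤o (threshold M u r) n-large)) marked≥ ⟩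
      M * (H * H) * totalGain + M * (H * H) * totalMarked
        ≡⟨ *-distribˡ-+ (M * (H * H)) totalGain totalMarked ⟨
      M * (H * H) * (totalGain + totalMarked)
        ≡⟨ cong (M * (H * H) *_) (trans (+-comm totalGain totalMarked) (trans
             (sym (∑-distrib-+ P (λ (i , j) → State.marked σ i j) (λ (i , j) → gain i j)))
             (∑-cong P λ (i , j) → sym (marked′ i j)))) ⟩
      M * (H * H) * Round.totalMarked refined ∎)
      where
      open ≤-Reasoning
      open Refine M H G σ
      open Round σ

    -- The marked area summed over all pairs `i < j` never exceeds `length P * (n * n)`, which
    -- bounds the number of rounds.
    impossible : ∀ R → M * (H * H) * length P < R → threshold M u R ≤ n → 0 < n → ⊥
    impossible R Qc<R n-large 0<n with rounds R n-large
    ... | σ , marked≥ = <⇒≱ (*-monoˡ-< (n * n) {{>-nonZero (*-mono-< 0<n 0<n)}} Qc<R) (begin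
      R * (n * n)                ≤⟨ marked≥ ⟩
      Q * Round.totalMarked σ    ≤⟨ *-monoʳ-≤ Q (Round.totalMarked≤ σ) ⟩
      Q * (c * (n * n))          ≡⟨ *-assoc Q c (n * n) ⟨
      Q * c * (n * n)            ∎)
      where
      open ≤-Reasoning
      Q = M * (H * H)
      c = length P

abstract
  linearSystem-bound : ∀ u q .{{_ : NonZero q}} → ∃ λ N → ∀ n → n ≥ N →
    (G : Graphs n (2 + u)) → ¬ Twins G (λ _ _ → true) →
    {X : Set} {W : List X} (w : X → Fin (2 + u) → Fin n) → Unique W → (∀ {a} → a ∈ W → Partite G (w a)) →
    (∀ {a b} → a ∈ W → b ∈ W → ∀ i j → i Fin.< j → w a i ≡ w b i → w a j ≡ w b j → a ≡ b) →
    q * length W ≤ n * n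
  -- `R` is one more than the number of rounds that the total area allows; the outer `suc` makes `n`
  -- positive, so that `n * n` can be cancelled.
  linearSystem-bound u q = suc (threshold M u R) ,
    λ n n≥N G no-twins w W-unique W-partite W-linear → ≮⇒≥ λ dense →
      impossible G no-twins w W-unique W-partite W-linear M q refl (1≤length-orderedPairs u) dense R ≤-refl (<⇒≤ n≥N) (≤-<-trans z≤n n≥N)
    where
    c M R : ℕ
    c = length (orderedPairs (2 + u))
    M = 4 * q * c
    R = suc (M * (shrink M (suc u) * shrink M (suc u)) * c)
    instance
      c≢0 : NonZero c
      c≢0 = >-nonZero (1≤length-orderedPairs u)
      4q≢0 : NonZero (4 * q)
      4q≢0 = m*n≢0 4 q
      M≢0 : NonZero M
      M≢0 = m*n≢0 (4 * q) c

-- Cliques as ranges of tuples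

element : (S : Sub.Subset n) → Fin Sub.∣ S ∣ → Fin n
element (Sub.inside  Vec.∷ S) zero    = zero
element (Sub.inside  Vec.∷ S) (suc i) = suc (element S i)
element (Sub.outside Vec.∷ S) i       = suc (element S i)

element∈ : (S : Sub.Subset n) (i : Fin Sub.∣ S ∣) → element S i Sub.∈ S
element∈ (Sub.inside  Vec.∷ S) zero    = Vec.here
element∈ (Sub.inside  Vec.∷ S) (suc i) = Vec.there (element∈ S i)
element∈ (Sub.outside Vec.∷ S) i       = Vec.there (element∈ S i)

element-injective : (S : Sub.Subset n) {i j : Fin Sub.∣ S ∣} → element S i ≡ element S j → i ≡ j
element-injective (Sub.inside  Vec.∷ S) {zero}  {zero}  eq = refl
element-injective (Sub.inside  Vec.∷ S) {suc i} {suc j} eq = cong suc (element-injective S (Fin.suc-injective eq))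
element-injective (Sub.outside Vec.∷ S)                 eq = element-injective S (Fin.suc-injective eq)

element-surjective : (S : Sub.Subset n) {x : Fin n} → x Sub.∈ S → ∃ λ i → element S i ≡ x
element-surjective (Sub.inside  Vec.∷ S) Vec.here      = zero , refl
element-surjective (Sub.inside  Vec.∷ S) (Vec.there p) = let i , eq = element-surjective S p in suc i , cong suc eq
element-surjective (Sub.outside Vec.∷ S) (Vec.there p) = let i , eq = element-surjective S p in i , cong suc eq

vertex : Clique n k → Fin k → Fin n
vertex (S , refl) = element S

vertex∈ : (K : Clique n k) (i : Fin k) → vertex K i Sub.∈ proj₁ K
vertex∈ (S , refl) = element∈ S

vertex-injective : (K : Clique n k) → Injective _≡_ _≡_ (vertex K)
vertex-injective (S , refl) = element-injective S

vertex-surjective : (K : Clique n k) {x : Fin n} → x Sub.∈ proj₁ K → ∃ λ i → vertex K i ≡ x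
vertex-surjective (S , refl) = element-surjective S

clique-⊆ : (K L : Clique n k) → proj₁ K Sub.⊆ proj₁ L → K ≡ L
clique-⊆ K@(S , p) L@(S′ , q) S⊆S′ = Clique-≡ (Sub.⊆-antisym S⊆S′ S′⊆S)
  where
  S′⊆S : S′ Sub.⊆ S
  S′⊆S {x} x∈S′ with x Sub.∈? S
  ... | yes x∈S = x∈S
  ... | no  x∉S = contradiction (Sub.p⊂q⇒∣p∣<∣q∣ (S⊆S′ , x , x∈S′ , x∉S)) (<-irrefl (trans p (sym q)))

range : (Fin k → Fin n) → Sub.Subset n
range f = Vec.tabulate λ x → does (Fin.any? λ i → f i Fin.≟ x)

range⁺ : (f : Fin k → Fin n) (i : Fin k) → f i Sub.∈ range f
range⁺ f i = Vec.lookup⇒[]= (f i) (range f)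
  (trans (Vec.lookup∘tabulate _ (f i)) (dec-true (Fin.any? λ j → f j Fin.≟ f i) (i , refl)))

range⁻ : (f : Fin k → Fin n) {x : Fin n} → x Sub.∈ range f → ∃ λ i → f i ≡ x
range⁻ f {x} x∈ = does-true (Fin.any? λ i → f i Fin.≟ x)
  (trans (sym (Vec.lookup∘tabulate _ x)) (Vec.[]=⇒lookup x∈))

∣range∣ : (f : Fin k → Fin n) → Injective _≡_ _≡_ f → Sub.∣ range f ∣ ≡ k
∣range∣ {k} {n} f f-inj = Fin.cantor-schröder-bernstein {f = from} {g = to} from-inj to-inj
  where
  S = range f
  from : Fin Sub.∣ S ∣ → Fin k
  from i = proj₁ (range⁻ f (element∈ S i))
  from-inj : Injective _≡_ _≡_ from
  from-inj {i} {j} eq = element-injective S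
    (trans (sym (proj₂ (range⁻ f (element∈ S i)))) (trans (cong f eq) (proj₂ (range⁻ f (element∈ S j)))))
  to : Fin k → Fin Sub.∣ S ∣
  to i = proj₁ (element-surjective S (range⁺ f i))
  to-inj : Injective _≡_ _≡_ to
  to-inj {i} {j} eq = f-inj
    (trans (sym (proj₂ (element-surjective S (range⁺ f i))))
      (trans (cong (element S) eq) (proj₂ (element-surjective S (range⁺ f j)))))

rangeClique : (f : Fin k → Fin n) → Injective _≡_ _≡_ f → Clique n k
rangeClique f f-inj = range f , ∣range∣ f f-inj

pair : Fin n → Fin n → Fin 2 → Fin n
pair x y zero    = x
pair x y (suc _) = y

pair-injective : {x y : Fin n} → x ≢ y → Injective _≡_ _≡_ (pair x y)
pair-injective x≢y {zero}     {zero}     eq = refl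
pair-injective x≢y {zero}     {suc zero} eq = contradiction eq x≢y
pair-injective x≢y {suc zero} {zero}     eq = contradiction (sym eq) x≢y
pair-injective x≢y {suc zero} {suc zero} eq = refl

edge : (x y : Fin n) → x ≢ y → Edge n
edge x y x≢y = rangeClique (pair x y) (pair-injective x≢y)

module _ {x y : Fin n} (x≢y : x ≢ y) where

  edge⁺ˡ : x Sub.∈ proj₁ (edge x y x≢y)
  edge⁺ˡ = range⁺ (pair x y) zero

  edge⁺ʳ : y Sub.∈ proj₁ (edge x y x≢y)
  edge⁺ʳ = range⁺ (pair x y) (suc zero)

  edge⁻ : ∀ {z} → z Sub.∈ proj₁ (edge x y x≢y) → z ≡ x ⊎ z ≡ y
  edge⁻ z∈ with range⁻ (pair x y) z∈
  ... | zero     , eq = inj₁ (sym eq)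
  ... | suc zero , eq = inj₂ (sym eq)

  edge-⊆ : {S : Sub.Subset n} → x Sub.∈ S → y Sub.∈ S → proj₁ (edge x y x≢y) Sub.⊆ S
  edge-⊆ x∈ y∈ z∈ with edge⁻ z∈
  ... | inj₁ refl = x∈
  ... | inj₂ refl = y∈

  edge-unique : (e : Edge n) → x Sub.∈ proj₁ e → y Sub.∈ proj₁ e → edge x y x≢y ≡ e
  edge-unique e x∈ y∈ = clique-⊆ (edge x y x≢y) e (edge-⊆ x∈ y∈)

edge-cong : {x y x′ y′ : Fin n} (x≢y : x ≢ y) (x′≢y′ : x′ ≢ y′) → x ≡ x′ → y ≡ y′ →
  edge x y x≢y ≡ edge x′ y′ x′≢y′
edge-cong x≢y x′≢y′ refl refl = Clique-≡ refl

ends : (e : Edge n) → ∃₂ λ x y → x Sub.∈ proj₁ e × y Sub.∈ proj₁ e × x ≢ y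
ends e = vertex e zero , vertex e (suc zero) , vertex∈ e zero , vertex∈ e (suc zero) ,
  λ eq → contradiction (vertex-injective e eq) λ ()

module _ (f : Fin k → Fin n) (f-inj : Injective _≡_ _≡_ f) where

  edge-in-range : (e : Edge n) → e ∈E rangeClique f f-inj →
    ∃₂ λ i j → i Fin.< j × ∃ λ fi≢fj → e ≡ edge (f i) (f j) fi≢fj
  edge-in-range e e∈ with ends e
  ... | x , y , x∈ , y∈ , x≢y with range⁻ f (e∈ x∈) | range⁻ f (e∈ y∈)
  ... | i , refl | j , refl with Fin.<-cmp i j
  ... | tri< i<j _ _ = i , j , i<j , x≢y , sym (edge-unique x≢y e x∈ y∈)
  ... | tri≈ _ i≡j _ = contradiction (cong f i≡j) x≢y
  ... | tri> _ _ j<i = j , i , j<i , x≢y ∘ sym , sym (edge-unique (x≢y ∘ sym) e y∈ x∈)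

  edge-of-range-injective : ∀ {i j i′ j′} → i Fin.< j → i′ Fin.< j′ →
    ∀ fi≢fj fi′≢fj′ → edge (f i) (f j) fi≢fj ≡ edge (f i′) (f j′) fi′≢fj′ → i ≡ i′ × j ≡ j′
  edge-of-range-injective {i} {j} {i′} {j′} i<j i′<j′ p q eq
    with edge⁻ q (subst (λ e → f i Sub.∈ proj₁ e) eq (edge⁺ˡ p)) | edge⁻ q (subst (λ e → f j Sub.∈ proj₁ e) eq (edge⁺ʳ p))
  ... | inj₁ a | inj₂ b = f-inj a , f-inj b
  ... | inj₁ a | inj₁ b = contradiction (trans a (sym b)) p
  ... | inj₂ a | inj₂ b = contradiction (trans a (sym b)) p
  ... | inj₂ a | inj₁ b with f-inj a | f-inj b
  ... | refl | refl = contradiction i<j (Fin.<-asym i′<j′)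

abstract
  colour : Colouring n → Fin n → Fin n → ℕ
  colour c x y with x Fin.≟ y
  -- A default on the diagonal, which carries no edge.
  ... | yes _   = 0
  ... | no  x≢y = c (edge x y x≢y)

  colour-edge : (c : Colouring n) {x y : Fin n} (x≢y : x ≢ y) → colour c x y ≡ c (edge x y x≢y)
  colour-edge c {x} {y} x≢y with x Fin.≟ y
  ... | yes x≡y = contradiction x≡y x≢y
  ... | no  x≢y′ = cong c (edge-unique x≢y′ (edge x y x≢y) (edge⁺ˡ x≢y) (edge⁺ʳ x≢y))

  colour-≤ : (c : Colouring n) {m : ℕ} → (∀ e → c e ≤ m) → ∀ x y → colour c x y ≤ m
  colour-≤ c c≤m x y with x Fin.≟ y
  ... | yes _   = z≤n
  ... | no  x≢y = c≤m (edge x y x≢y)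

-- The upper bound

allows : Maybe (Fin q) → Fin q → Bool
allows nothing  v = true
allows (just u) v = does (u Fin.≟ v)

-- `f` is a partial function with `nothing` for undefined values, and the test is whether `χ`
-- extends it.
satisfies : (Fin N → Maybe (Fin q)) → (Fin N → Fin q) → Bool
satisfies {zero}  f χ = true
satisfies {suc N} f χ = allows (f zero) (χ zero) ∧ satisfies (f ∘ suc) (χ ∘ suc)

satisfies-just : ∀ (f : Fin N → Maybe (Fin q)) χ → satisfies f χ ≡ true → ∀ i {v} → f i ≡ just v → χ i ≡ v
satisfies-just {suc N} f χ sat zero    {v} eq with ∧-true (allows (f zero) (χ zero)) sat
... | ok , _ rewrite eq = sym (does-true (v Fin.≟ χ zero) ok)
satisfies-just {suc N} f χ sat (suc i) eq =
  satisfies-just (f ∘ suc) (χ ∘ suc) (proj₂ (∧-true (allows (f zero) (χ zero)) sat)) i eq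

undefineds : (Fin N → Maybe (Fin q)) → ℕ
undefineds {N} f = ∑[ i < N ] ⟦ is-nothing (f i) ⟧

module _ {X : Set} (W : List X) where

  -- The method of conditional expectations for a uniformly random χ, weights scaled by q ^ N.
  assignment : ∀ N q .{{_ : NonZero q}} (g : X → ℕ) (f : X → Fin N → Maybe (Fin q)) →
    ∃ λ χ → ∑[ a ∈ W ] (g a * q ^ undefineds (f a)) ≤ q ^ N * ∑[ a ∈ W ] (g a * ⟦ satisfies (f a) χ ⟧)
  assignment zero    q g f = (λ ()) , ≤-reflexive (sym (+-identityʳ _))
  assignment (suc N) q g f = cons v χ , (begin
    ∑[ a ∈ W ] (g a * q ^ undefineds (f a))  ≤⟨ v-good ⟩
    length (allFin q) * Φ v                  ≡⟨ cong (_* Φ v) (length-allFin q) ⟩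
    q * Φ v                                  ≤⟨ *-monoʳ-≤ q χ-good ⟩
    q * (q ^ N * ∑[ a ∈ W ] (g a * ⟦ allows (f a zero) v ⟧ * ⟦ satisfies (f a ∘ suc) χ ⟧))
      ≡⟨ *-assoc q (q ^ N) _ ⟨
    q ^ suc N * ∑[ a ∈ W ] (g a * ⟦ allows (f a zero) v ⟧ * ⟦ satisfies (f a ∘ suc) χ ⟧)
      ≡⟨ cong (q ^ suc N *_) (∑-cong W λ a → trans (*-assoc (g a) _ _)
           (cong (g a *_) (sym (⟦∧⟧ (allows (f a zero) v) _)))) ⟩
    q ^ suc N * ∑[ a ∈ W ] (g a * ⟦ satisfies (f a) (cons v χ) ⟧) ∎)
    where
    open ≤-Reasoning
    cons : Fin q → (Fin N → Fin q) → Fin (suc N) → Fin q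
    cons v χ zero    = v
    cons v χ (suc i) = χ i
    Φ : Fin q → ℕ
    Φ v = ∑[ a ∈ W ] (g a * ⟦ allows (f a zero) v ⟧ * q ^ undefineds (f a ∘ suc))
    -- A free coordinate admits all `q` values of `v`, a prescribed one admits a single value;
    -- either way the weight splits exactly over the choices of `v`.
    branch : ∀ (m : Maybe (Fin q)) c d → c * q ^ (⟦ is-nothing m ⟧ + d) ≡ ∑[ v < q ] (c * ⟦ allows m v ⟧ * q ^ d)
    branch nothing c d = begin-equality
      c * (q * q ^ d)                     ≡⟨ lemma c q (q ^ d) ⟩
      q * (c * 1 * q ^ d)                 ≡⟨ cong (_* (c * 1 * q ^ d)) (length-allFin q) ⟨
      length (allFin q) * (c * 1 * q ^ d) ≡⟨ ∑-const (allFin q) _ ⟨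
      ∑[ v < q ] (c * 1 * q ^ d)          ∎
      where
      lemma : ∀ c q d → c * (q * d) ≡ q * (c * 1 * d)
      lemma = solve-∀
    branch (just u) c d = begin-equality
      c * q ^ d                                          ≡⟨ ∑-δ u (c * q ^ d) ⟨
      ∑[ v < q ] (⟦ does (u Fin.≟ v) ⟧ * (c * q ^ d))    ≡⟨ ∑-cong (allFin q) (λ v → lemma ⟦ does (u Fin.≟ v) ⟧ c (q ^ d)) ⟩
      ∑[ v < q ] (c * ⟦ does (u Fin.≟ v) ⟧ * q ^ d)      ∎
      where
      lemma : ∀ b c d → b * (c * d) ≡ c * b * d
      lemma = solve-∀
    total : ∑[ a ∈ W ] (g a * q ^ undefineds (f a)) ≤ ∑[ v < q ] Φ v
    total = ≤-reflexive (trans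
      (∑-cong W λ a → trans (cong (λ m → g a * q ^ m) (∑ᶠ-suc (λ i → ⟦ is-nothing (f a i) ⟧)))
        (branch (f a zero) (g a) (undefineds (f a ∘ suc))))
      (∑-swap W (allFin q) _))
    choice = ∑-averaging (allFin q) Φ (≤-trans (>-nonZero⁻¹ q) (≤-reflexive (sym (length-allFin q)))) total
    v = proj₁ choice
    v-good = proj₂ (proj₂ choice)
    rest = assignment N q (λ a → g a * ⟦ allows (f a zero) v ⟧) (λ a → f a ∘ suc)
    χ = proj₁ rest
    χ-good = proj₂ rest

∑-atMostOne : (h : Fin N → Bool) → (∀ i j → h i ≡ true → h j ≡ true → i ≡ j) → ∑[ i < N ] ⟦ h i ⟧ ≤ 1
∑-atMostOne {N} h inj with Fin.any? (λ i → h i Bool.≟ true)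
... | no none = ≤-trans (∑-mono (allFin N) {g = λ _ → 0} λ i → zero-term i) (≤-trans (≤-reflexive (∑-zero (allFin N))) z≤n)
  where
  zero-term : ∀ i → ⟦ h i ⟧ ≤ 0
  zero-term i with h i in eq
  ... | true  = contradiction (i , eq) none
  ... | false = z≤n
... | yes (i , hi) = ≤-trans (∑-mono (allFin N) term) (≤-reflexive (∑-δ i 1))
  where
  term : ∀ j → ⟦ h j ⟧ ≤ ⟦ does (i Fin.≟ j) ⟧ * 1
  term j with h j in eq
  ... | false = z≤n
  ... | true  = ≤-reflexive (sym (trans (*-identityʳ _) (cong ⟦_⟧ (dec-true (i Fin.≟ j) (inj i j hi eq)))))

takes : Maybe (Fin q) → Fin q → Bool
takes nothing  v = false
takes (just u) v = does (u Fin.≟ v)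

takes-true : ∀ (m : Maybe (Fin q)) {v} → takes m v ≡ true → m ≡ just v
takes-true (just u) {v} eq = cong just (does-true (u Fin.≟ v) eq)

-- Each of the `q` values is taken at most once, so at most `q` coordinates are defined.
undefineds-≥ : (f : Fin N → Maybe (Fin q)) → (∀ i j v → f i ≡ just v → f j ≡ just v → i ≡ j) → N ≤ undefineds f + q
undefineds-≥ {N} {q} f inj = begin
  N                                                         ≡⟨ length-allFin N ⟨
  length (allFin N)                                         ≡⟨ ∑-one (allFin N) ⟨
  ∑[ i < N ] 1                                              ≤⟨ ∑-mono (allFin N) (λ i → defined-or-not (f i)) ⟩
  ∑[ i < N ] (⟦ is-nothing (f i) ⟧ + ∑[ v < q ] ⟦ takes (f i) v ⟧) ≡⟨ ∑-distrib-+ (allFin N) _ _ ⟩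
  undefineds f + ∑[ i < N ] ∑[ v < q ] ⟦ takes (f i) v ⟧    ≡⟨ cong (undefineds f +_) (∑-swap (allFin N) (allFin q) _) ⟩
  undefineds f + ∑[ v < q ] ∑[ i < N ] ⟦ takes (f i) v ⟧
    ≤⟨ +-monoʳ-≤ (undefineds f) (∑-≤-const (allFin q) λ v → ∑-atMostOne (λ i → takes (f i) v)
         λ i j p r → inj i j v (takes-true (f i) p) (takes-true (f j) r)) ⟩
  undefineds f + length (allFin q) * 1                      ≡⟨ cong (undefineds f +_) (trans (*-identityʳ _) (length-allFin q)) ⟩
  undefineds f + q                                          ∎
  where
  open ≤-Reasoning
  defined-or-not : ∀ (m : Maybe (Fin q)) → 1 ≤ ⟦ is-nothing m ⟧ + ∑[ v < q ] ⟦ takes m v ⟧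
  defined-or-not nothing  = m≤m+n 1 _
  defined-or-not (just u) = ≤-reflexive (sym (trans
    (∑-cong (allFin q) λ v → sym (*-identityʳ ⟦ does (u Fin.≟ v) ⟧)) (∑-δ u 1)))

-- A random `χ` extends a given `f a` with probability at least `1 / q ^ q`, since at most `q` of
-- its values are prescribed. The bound does not involve `N`, which will be governed by the colours
-- of an arbitrary colouring.
goodAssignment : ∀ {X : Set} N q .{{_ : NonZero q}} (W : List X) (f : X → Fin N → Maybe (Fin q)) →
  (∀ {a} → a ∈ W → ∀ i j v → f a i ≡ just v → f a j ≡ just v → i ≡ j) →
  ∃ λ χ → length W ≤ q ^ q * ∑[ a ∈ W ] ⟦ satisfies (f a) χ ⟧
goodAssignment N q W f inj = χ , *-cancelˡ-≤ (q ^ N) {{m^n≢0 q N}} (begin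
  q ^ N * length W                                  ≡⟨ *-comm (q ^ N) (length W) ⟩
  length W * q ^ N                                  ≡⟨ ∑-const W (q ^ N) ⟨
  ∑[ a ∈ W ] (q ^ N)                                ≤⟨ ∑-mono∈ W (λ {a} a∈ → ≤-trans (^-monoʳ-≤ q (undefineds-≥ (f a) (inj a∈)))
                                                       (≤-reflexive (trans (^-distribˡ-+-* q (undefineds (f a)) q) (*-comm _ (q ^ q))))) ⟩
  ∑[ a ∈ W ] (q ^ q * q ^ undefineds (f a))         ≡⟨ *-distribˡ-∑ (q ^ q) W _ ⟨
  q ^ q * ∑[ a ∈ W ] (q ^ undefineds (f a))         ≡⟨ cong (q ^ q *_) (∑-cong W λ a → sym (*-identityˡ _)) ⟩
  q ^ q * ∑[ a ∈ W ] (1 * q ^ undefineds (f a))     ≤⟨ *-monoʳ-≤ (q ^ q) χ-good ⟩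
  q ^ q * (q ^ N * ∑[ a ∈ W ] (1 * ⟦ satisfies (f a) χ ⟧)) ≡⟨ *-left-comm (q ^ q) (q ^ N) _ ⟩
  q ^ N * (q ^ q * ∑[ a ∈ W ] (1 * ⟦ satisfies (f a) χ ⟧)) ≡⟨ cong (λ m → q ^ N * (q ^ q * m)) (∑-cong W λ a → *-identityˡ _) ⟩
  q ^ N * (q ^ q * ∑[ a ∈ W ] ⟦ satisfies (f a) χ ⟧)       ∎)
  where
  open ≤-Reasoning
  choice = assignment W N q (λ _ → 1) f
  χ = proj₁ choice
  χ-good = proj₂ choice

-- From rainbow cliques to partite tuples

module _ {n t : ℕ} (c : Colouring n) (K : Clique n t) (rb : Rainbow c K) where

  rainbow-colour : ∀ {i j i′ j′} → i Fin.< j → i′ Fin.< j′ →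
    colour c (vertex K i) (vertex K j) ≡ colour c (vertex K i′) (vertex K j′) → i ≡ i′ × j ≡ j′
  rainbow-colour {i} {j} {i′} {j′} i<j i′<j′ eq =
    edge-of-range-injective (vertex K) (vertex-injective K) i<j i′<j′ (distinct i<j) (distinct i′<j′)
      (rb _ _ (edge-⊆ (distinct i<j) (vertex∈ K i) (vertex∈ K j)) (edge-⊆ (distinct i′<j′) (vertex∈ K i′) (vertex∈ K j′))
        (trans (sym (colour-edge c (distinct i<j))) (trans eq (colour-edge c (distinct i′<j′)))))
    where
    distinct : ∀ {i j} → i Fin.< j → vertex K i ≢ vertex K j
    distinct i<j eq = Fin.<⇒≢ i<j (vertex-injective K eq)

abstract
  slots : ℕ → ℕ
  slots t = t * t

  slots≢0 : ∀ t → NonZero (slots (suc t))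
  slots≢0 t = _

  pairSlot : Fin k → Fin k → Fin (slots k)
  pairSlot = combine

  pairSlot-injective : ∀ (i j i′ j′ : Fin k) → pairSlot i j ≡ pairSlot i′ j′ → i ≡ i′ × j ≡ j′
  pairSlot-injective = Fin.combine-injective

module UpperBound {n t : ℕ} (c : Colouring n) (ag : AlmostGallai t c)
  (two-others : (k : Fin t) → ∃₂ λ i j → i ≢ k × j ≢ k × i ≢ j) .{{_ : NonZero (slots t)}} where

  private
    -- The sum of all colours dominates each of them, so the colours lie in the finite set
    -- `Fin bound`, on which a class map can be chosen.
    bound : ℕ
    bound = suc (∑ (cliques n 2) c)

  W : List (Clique n t)
  W = filter (rainbow? c) (cliques n t)

  W-rainbow : ∀ {K} → K ∈ W → Rainbow c K
  W-rainbow K∈ = proj₂ (∈-filter⁻ (rainbow? c) {xs = cliques n t} K∈)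

  abstract
    code : Fin n → Fin n → Fin bound
    code x y = fromℕ< (s≤s (colour-≤ c (λ e → term≤∑ c (∈-cliques e)) x y))

    toℕ-code : ∀ x y → toℕ (code x y) ≡ colour c x y
    toℕ-code x y = Fin.toℕ-fromℕ< _

  Slot : Clique n t → Fin bound → Set
  Slot K γ = ∃₂ λ i j → i Fin.< j × colour c (vertex K i) (vertex K j) ≡ toℕ γ

  slot? : ∀ K γ → Dec (Slot K γ)
  slot? K γ = Fin.any? λ i → Fin.any? λ j → (i Fin.<? j) ×-dec (colour c (vertex K i) (vertex K j) ≟ toℕ γ)

  slotFrom : ∀ K γ → Dec (Slot K γ) → Maybe (Fin (slots t))
  slotFrom K γ (yes (i , j , _)) = just (pairSlot i j)
  slotFrom K γ (no _)            = nothing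

  slotFrom-just : ∀ K γ (d : Dec (Slot K γ)) {v} → slotFrom K γ d ≡ just v →
    ∃₂ λ i j → colour c (vertex K i) (vertex K j) ≡ toℕ γ × pairSlot i j ≡ v
  slotFrom-just K γ (yes (i , j , _ , p)) eq = i , j , p , just-injective eq

  -- In a rainbow clique a colour occurs on only one pair, so whichever pair the search returned is
  -- the given one.
  slotFrom-complete : ∀ K γ (d : Dec (Slot K γ)) → Rainbow c K → ∀ {i j} → i Fin.< j →
    colour c (vertex K i) (vertex K j) ≡ toℕ γ → slotFrom K γ d ≡ just (pairSlot i j)
  slotFrom-complete K γ (no ¬p) rb i<j p = contradiction (_ , _ , i<j , p) ¬p
  slotFrom-complete K γ (yes (i′ , j′ , i′<j′ , p′)) rb i<j p =
    let i′≡i , j′≡j = rainbow-colour c K rb i′<j′ i<j (trans p′ (sym p)) in cong just (cong₂ pairSlot i′≡i j′≡j)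

  -- The class that `K` prescribes for each of its own colours, undefined on all other colours.
  slot : Clique n t → Fin bound → Maybe (Fin (slots t))
  slot K γ = slotFrom K γ (slot? K γ)

  slot-injective : ∀ K γ δ v → slot K γ ≡ just v → slot K δ ≡ just v → γ ≡ δ
  slot-injective K γ δ v p r =
    let i , j , γ≡ , eq = slotFrom-just K γ (slot? K γ) p
        i′ , j′ , δ≡ , eq′ = slotFrom-just K δ (slot? K δ) r
        i≡i′ , j≡j′ = pairSlot-injective i j i′ j′ (trans eq (sym eq′))
    in Fin.toℕ-injective (trans (sym γ≡) (trans (cong₂ (λ i j → colour c (vertex K i) (vertex K j)) i≡i′ j≡j′) δ≡))

  slot-complete : ∀ K → Rainbow c K → ∀ {i j} → i Fin.< j →
    slot K (code (vertex K i) (vertex K j)) ≡ just (pairSlot i j)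
  slot-complete K rb {i} {j} i<j =
    slotFrom-complete K (code (vertex K i) (vertex K j)) (slot? K (code (vertex K i) (vertex K j))) rb i<j (sym (toℕ-code (vertex K i) (vertex K j)))

  module Classes (χ : Fin bound → Fin (slots t)) where

    class : Fin n → Fin n → Fin (slots t)
    class x y = χ (code x y)

    -- The inequality is tested separately because `code` takes a default value on the diagonal,
    -- which `χ` may send to any class.
    G : Graphs n t
    G i j x y = not (does (x Fin.≟ y)) ∧ does (class x y Fin.≟ pairSlot i j)

    G⇒≢ : ∀ {i j x y} → G i j x y ≡ true → x ≢ y
    G⇒≢ {x = x} {y} eq x≡y with x Fin.≟ y
    ... | no x≢y = x≢y x≡y

    G⇒class : ∀ {i j x y} → G i j x y ≡ true → class x y ≡ pairSlot i j
    G⇒class {i} {j} {x} {y} eq = does-true (class x y Fin.≟ pairSlot i j) (proj₂ (∧-true (not (does (x Fin.≟ y))) eq))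

    G⁺ : ∀ {i j x y} → x ≢ y → class x y ≡ pairSlot i j → G i j x y ≡ true
    G⁺ {i} {j} {x} {y} x≢y eq = true-∧ (cong not (dec-false (x Fin.≟ y) x≢y)) (dec-true (class x y Fin.≟ pairSlot i j) eq)

    W′ : List (Clique n t)
    W′ = filter (λ K → Bool.T? (satisfies (slot K) χ)) W

    W′∈ : ∀ {K} → K ∈ W′ → K ∈ W × satisfies (slot K) χ ≡ true
    W′∈ {K} K∈ with ∈-filter⁻ (λ K → Bool.T? (satisfies (slot K) χ)) {xs = W} K∈
    ... | K∈W , p with satisfies (slot K) χ
    ... | true = K∈W , refl

    W′-partite : ∀ {K} → K ∈ W′ → Partite G (vertex K)
    W′-partite {K} K∈ i j i<j = G⁺ {i} {j} (λ eq → Fin.<⇒≢ i<j (vertex-injective K eq))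
      (satisfies-just (slot K) χ (proj₂ (W′∈ K∈)) (code (vertex K i) (vertex K j))
        (slot-complete K (W-rainbow {K} (proj₁ (W′∈ K∈))) i<j))

    shared-edge : ∀ (K L : Clique n t) → Rainbow c K → Rainbow c L → ∀ {x y} → x ≢ y →
      x Sub.∈ proj₁ K → y Sub.∈ proj₁ K → x Sub.∈ proj₁ L → y Sub.∈ proj₁ L → K ≡ L
    shared-edge K L rbK rbL {x} {y} x≢y xK yK xL yL = decidable-stable (K ≟ᶜ L) λ K≢L →
      ag K L rbK rbL K≢L (edge x y x≢y , edge-⊆ x≢y xK yK , edge-⊆ x≢y xL yL)

    W′-linear : ∀ {K L} → K ∈ W′ → L ∈ W′ → ∀ i j → i Fin.< j →
      vertex K i ≡ vertex L i → vertex K j ≡ vertex L j → K ≡ L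
    W′-linear {K} {L} K∈ L∈ i j i<j p r = shared-edge K L (W-rainbow {K} (proj₁ (W′∈ K∈))) (W-rainbow {L} (proj₁ (W′∈ L∈)))
      (λ eq → Fin.<⇒≢ i<j (vertex-injective K eq)) (vertex∈ K i) (vertex∈ K j)
      (subst (Sub._∈ proj₁ L) (sym p) (vertex∈ L i)) (subst (Sub._∈ proj₁ L) (sym r) (vertex∈ L j))

    module _ {x : Fin t → Fin n} (px : Partite G x) where

      partite-injective : Injective _≡_ _≡_ x
      partite-injective {i} {j} eq with Fin.<-cmp i j
      ... | tri< i<j _ _ = contradiction eq (G⇒≢ {i} {j} (px i j i<j))
      ... | tri≈ _ i≡j _ = i≡j
      ... | tri> _ _ j<i = contradiction (sym eq) (G⇒≢ {j} {i} (px j i j<i))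

      partiteClique : Clique n t
      partiteClique = rangeClique x partite-injective

      -- The class of an edge is a function of its colour, and in a partite tuple different pairs of
      -- positions lie in different classes. So different edges have different colours, whether or
      -- not the tuple comes from `W`.
      partite-rainbow : Rainbow c partiteClique
      partite-rainbow e f e∈ f∈ eq =
        let i , j , i<j , p , e≡ = edge-in-range x partite-injective e e∈
            i′ , j′ , i′<j′ , p′ , f≡ = edge-in-range x partite-injective f f∈
            same-class : class (x i) (x j) ≡ class (x i′) (x j′)
            same-class = cong χ (Fin.toℕ-injective (begin
              toℕ (code (x i) (x j))       ≡⟨ toℕ-code (x i) (x j) ⟩
              colour c (x i) (x j)         ≡⟨ colour-edge c p ⟩
              c (edge (x i) (x j) p)       ≡⟨ cong c e≡ ⟨
              c e                          ≡⟨ eq ⟩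
              c f                          ≡⟨ cong c f≡ ⟩
              c (edge (x i′) (x j′) p′)    ≡⟨ colour-edge c p′ ⟨
              colour c (x i′) (x j′)       ≡⟨ toℕ-code (x i′) (x j′) ⟨
              toℕ (code (x i′) (x j′))     ∎))
            i≡i′ , j≡j′ = pairSlot-injective i j i′ j′
              (trans (sym (G⇒class {i} {j} (px i j i<j))) (trans same-class (G⇒class {i′} {j′} (px i′ j′ i′<j′))))
        in trans e≡ (trans (edge-cong p p′ (cong x i≡i′) (cong x j≡j′)) (sym f≡))
        where open ≡-Reasoning

    -- Twins share the vertices at two positions other than the pivot, hence an edge, so their
    -- cliques coincide. Then `x′ pivot` is `x m` for some `m`; if `m` were not the pivot, `x′`
    -- would take this value twice.
    no-twins : ¬ Twins G (λ _ _ → true)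
    no-twins tw = differ (sym (x′k≡xk))
      where
      open Twins tw
      i j : Fin t
      i = proj₁ (two-others pivot)
      j = proj₁ (proj₂ (two-others pivot))
      i≢ : i ≢ pivot
      i≢ = proj₁ (proj₂ (proj₂ (two-others pivot)))
      j≢ : j ≢ pivot
      j≢ = proj₁ (proj₂ (proj₂ (proj₂ (two-others pivot))))
      i≢j : i ≢ j
      i≢j = proj₂ (proj₂ (proj₂ (proj₂ (two-others pivot))))
      same : partiteClique {x} partite ≡ partiteClique {x′} partite′
      same = shared-edge (partiteClique {x} partite) (partiteClique {x′} partite′)
        (partite-rainbow {x} partite) (partite-rainbow {x′} partite′)
        (λ eq → i≢j (partite-injective {x} partite eq)) (range⁺ x i) (range⁺ x j)
        (subst (Sub._∈ range x′) (sym (agree i i≢)) (range⁺ x′ i))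
        (subst (Sub._∈ range x′) (sym (agree j j≢)) (range⁺ x′ j))
      at-pivot : ∀ m → x m ≡ x′ pivot → x′ pivot ≡ x pivot
      at-pivot m xm≡ with m Fin.≟ pivot
      ... | yes refl = sym xm≡
      ... | no m≢    = contradiction (partite-injective {x′} partite′ (trans (sym (agree m m≢)) xm≡)) m≢
      x′k≡xk : x′ pivot ≡ x pivot
      x′k≡xk = let m , xm≡ = range⁻ x (subst (x′ pivot Sub.∈_) (sym (cong proj₁ same)) (range⁺ x′ pivot)) in at-pivot m xm≡

    W′-unique : Unique W′
    W′-unique = Unique.filter⁺ (λ K → Bool.T? (satisfies (slot K) χ)) (Unique.filter⁺ (rainbow? c) (cliques-unique n t))

    length-W′ : ∑[ K ∈ W ] ⟦ satisfies (slot K) χ ⟧ ≡ length W′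
    length-W′ = ∑-filter (λ K → Bool.T? (satisfies (slot K) χ)) W

  -- The factor `slots t ^ slots t` pays for passing from `W` to `W′`, the cliques respected by `χ`.
  count-bound : ∀ q → (∀ (G : Graphs n t) → ¬ Twins G (λ _ _ → true) → {W : List (Clique n t)} → Unique W →
      (∀ {K} → K ∈ W → Partite G (vertex K)) →
      (∀ {K L} → K ∈ W → L ∈ W → ∀ i j → i Fin.< j → vertex K i ≡ vertex L i → vertex K j ≡ vertex L j → K ≡ L) →
      q * slots t ^ slots t * length W ≤ n * n) →
    q * rainbowCount t c ≤ n * n
  count-bound q linear-bound = begin
    q * length W                                                       ≤⟨ *-monoʳ-≤ q (proj₂ good) ⟩
    q * (slots t ^ slots t * ∑[ K ∈ W ] ⟦ satisfies (slot K) χ ⟧)      ≡⟨ *-assoc q (slots t ^ slots t) _ ⟨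
    q * slots t ^ slots t * ∑[ K ∈ W ] ⟦ satisfies (slot K) χ ⟧        ≡⟨ cong (q * slots t ^ slots t *_) length-W′ ⟩
    q * slots t ^ slots t * length W′                                  ≤⟨ linear-bound G no-twins {W′} W′-unique (λ {K} → W′-partite {K}) (λ {K} {L} → W′-linear {K} {L}) ⟩
    n * n                                                              ∎
    where
    open ≤-Reasoning
    good : ∃ λ χ → length W ≤ slots t ^ slots t * ∑[ K ∈ W ] ⟦ satisfies (slot K) χ ⟧
    good = goodAssignment bound (slots t) W slot (λ {K} _ → slot-injective K)
    χ : Fin bound → Fin (slots t)
    χ = proj₁ good
    open Classes χ

two-others : {u : ℕ} (k : Fin (3 + u)) → ∃₂ λ i j → i ≢ k × j ≢ k × i ≢ j
two-others zero          = suc zero , suc (suc zero) , (λ ()) , (λ ()) , λ ()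
two-others (suc zero)    = zero , suc (suc zero) , (λ ()) , (λ ()) , λ ()
two-others (suc (suc k)) = zero , suc zero , (λ ()) , (λ ()) , λ ()

abstract
  rainbowCount-bound : ∀ u q .{{_ : NonZero q}} → ∃ λ N → ∀ n → n ≥ N →
    (c : Colouring n) → AlmostGallai (3 + u) c → q * rainbowCount (3 + u) c ≤ n * n
  rainbowCount-bound u q = N₀ , λ n n≥N₀ c ag →
    UpperBound.count-bound c ag two-others q λ G no-twins {W} → proj₂ (linearSystem-bound (1 + u) (q * s ^ s)) n n≥N₀ G no-twins {W = W} vertex
    where
    s N₀ : ℕ
    s = slots (3 + u)
    instance
      s≢0 : NonZero s
      s≢0 = slots≢0 (2 + u)
      s^s≢0 : NonZero (s ^ s)
      s^s≢0 = m^n≢0 s s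
      qs^s≢0 : NonZero (q * s ^ s)
      qs^s≢0 = m*n≢0 q (s ^ s)
    N₀ = proj₁ (linearSystem-bound (1 + u) (q * s ^ s))

τ-littleO : ∀ t → 3 ≤ t → LittleO (τ t) (λ n → n ^ 2)
-- It is enough to reach `1 / q`, which is at most `p / q`. `τ` is replaced by the count of a
-- colouring attaining it.
τ-littleO (suc (suc (suc u))) (s≤s (s≤s (s≤s _))) p q = N₀ , λ n n≥N₀ → let (c , ag , count≡) , _ = τ-isMax (3 + u) n in begin
  q * τ (3 + u) n               ≡⟨ cong (q *_) count≡ ⟨
  q * rainbowCount (3 + u) c    ≤⟨ bound n n≥N₀ c ag ⟩
  n * n                         ≡⟨ cong (n *_) (*-identityʳ n) ⟨
  n ^ 2                         ≤⟨ m≤n*m (n ^ 2) p ⟩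
  p * n ^ 2                     ∎
  where
  open ≤-Reasoning
  N₀ = proj₁ (rainbowCount-bound u q)
  bound = proj₂ (rainbowCount-bound u q)

-- The lower bound

-- The squared Euclidean norm.
sq : (Fin D → ℤ) → ℤ
sq {zero}  a = ⁺ 0
sq {suc D} a = a zero ℤ.* a zero ℤ.+ sq (a ∘ suc)

square-nonneg : ∀ i → i ℤ.* i ≡ ⁺ (ℤ.∣ i ∣ * ℤ.∣ i ∣)
square-nonneg (⁺ n)    = sym (ℤ.pos-* n n)
square-nonneg -[1+ n ] = refl

sq-nonneg : (a : Fin D → ℤ) → ∃ λ m → sq a ≡ ⁺ m
sq-nonneg {zero}  a = 0 , refl
sq-nonneg {suc D} a = let m , eq = sq-nonneg (a ∘ suc) in
  ℤ.∣ a zero ∣ * ℤ.∣ a zero ∣ + m , cong₂ ℤ._+_ (square-nonneg (a zero)) eq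

sq≡0 : (a : Fin D → ℤ) → sq a ≡ ⁺ 0 → ∀ d → a d ≡ ⁺ 0
sq≡0 {suc D} a eq with sq-nonneg (a ∘ suc)
... | m , eq′ = λ { zero → head ; (suc d) → sq≡0 (a ∘ suc) (trans eq′ (cong ⁺_ m≡0)) d }
  where
  total : ℤ.∣ a zero ∣ * ℤ.∣ a zero ∣ + m ≡ 0
  total = ℤ.+-injective (trans (sym (cong₂ ℤ._+_ (square-nonneg (a zero)) eq′)) eq)
  m≡0 : m ≡ 0
  m≡0 = m+n≡0⇒n≡0 (ℤ.∣ a zero ∣ * ℤ.∣ a zero ∣) total
  head : a zero ≡ ⁺ 0
  head with m*n≡0⇒m≡0∨n≡0 ℤ.∣ a zero ∣ (m+n≡0⇒m≡0 (ℤ.∣ a zero ∣ * ℤ.∣ a zero ∣) total)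
  ... | inj₁ z = ℤ.∣i∣≡0⇒i≡0 z
  ... | inj₂ z = ℤ.∣i∣≡0⇒i≡0 z

module _ (α β : ℤ) where

  private
    γ : ℤ
    γ = α ℤ.+ β

  -- With `αa + βb` in place of `γc` this is `αβ|a - b|² + |αa + βb|² = (α + β)(α|a|² + β|b|²)`,
  -- which holds coordinate by coordinate and for weights of any sign.
  convexity-identity : (a b c : Fin D → ℤ) → (∀ d → α ℤ.* a d ℤ.+ β ℤ.* b d ≡ γ ℤ.* c d) →
    α ℤ.* β ℤ.* sq (λ d → a d ℤ.- b d) ℤ.+ γ ℤ.* γ ℤ.* sq c ≡ γ ℤ.* (α ℤ.* sq a ℤ.+ β ℤ.* sq b)
  convexity-identity {zero}  a b c h = base α β
    where
    base : ∀ α β → α ℤ.* β ℤ.* ⁺ 0 ℤ.+ (α ℤ.+ β) ℤ.* (α ℤ.+ β) ℤ.* ⁺ 0 ≡ (α ℤ.+ β) ℤ.* (α ℤ.* ⁺ 0 ℤ.+ β ℤ.* ⁺ 0)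
    base = ℤ.solve-∀
  convexity-identity {suc D} a b c h = begin
    α ℤ.* β ℤ.* ((x ℤ.- y) ℤ.* (x ℤ.- y) ℤ.+ Q) ℤ.+ γ ℤ.* γ ℤ.* (z ℤ.* z ℤ.+ R)
      ≡⟨ split α β (x ℤ.- y) z Q R ⟩
    α ℤ.* β ℤ.* ((x ℤ.- y) ℤ.* (x ℤ.- y)) ℤ.+ γ ℤ.* z ℤ.* (γ ℤ.* z) ℤ.+ (α ℤ.* β ℤ.* Q ℤ.+ γ ℤ.* γ ℤ.* R)
      ≡⟨ cong₂ ℤ._+_ (cong (λ w → α ℤ.* β ℤ.* ((x ℤ.- y) ℤ.* (x ℤ.- y)) ℤ.+ w ℤ.* w) (sym (h zero)))
           (convexity-identity (a ∘ suc) (b ∘ suc) (c ∘ suc) (h ∘ suc)) ⟩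
    α ℤ.* β ℤ.* ((x ℤ.- y) ℤ.* (x ℤ.- y)) ℤ.+ (α ℤ.* x ℤ.+ β ℤ.* y) ℤ.* (α ℤ.* x ℤ.+ β ℤ.* y) ℤ.+ γ ℤ.* (α ℤ.* A ℤ.+ β ℤ.* B)
      ≡⟨ merge α β x y A B ⟩
    γ ℤ.* (α ℤ.* (x ℤ.* x ℤ.+ A) ℤ.+ β ℤ.* (y ℤ.* y ℤ.+ B)) ∎
    where
    open ≡-Reasoning
    x = a zero
    y = b zero
    z = c zero
    Q = sq (λ d → a (suc d) ℤ.- b (suc d))
    A = sq (a ∘ suc)
    B = sq (b ∘ suc)
    R = sq (c ∘ suc)
    split : ∀ α β w z Q R → α ℤ.* β ℤ.* (w ℤ.* w ℤ.+ Q) ℤ.+ (α ℤ.+ β) ℤ.* (α ℤ.+ β) ℤ.* (z ℤ.* z ℤ.+ R) ≡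
      α ℤ.* β ℤ.* (w ℤ.* w) ℤ.+ (α ℤ.+ β) ℤ.* z ℤ.* ((α ℤ.+ β) ℤ.* z) ℤ.+ (α ℤ.* β ℤ.* Q ℤ.+ (α ℤ.+ β) ℤ.* (α ℤ.+ β) ℤ.* R)
    split = ℤ.solve-∀
    merge : ∀ α β x y A B →
      α ℤ.* β ℤ.* ((x ℤ.- y) ℤ.* (x ℤ.- y)) ℤ.+ (α ℤ.* x ℤ.+ β ℤ.* y) ℤ.* (α ℤ.* x ℤ.+ β ℤ.* y) ℤ.+ (α ℤ.+ β) ℤ.* (α ℤ.* A ℤ.+ β ℤ.* B) ≡
      (α ℤ.+ β) ℤ.* (α ℤ.* (x ℤ.* x ℤ.+ A) ℤ.+ β ℤ.* (y ℤ.* y ℤ.+ B))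
    merge = ℤ.solve-∀

  -- When all three squared norms are `r`, the identity reduces to `αβ|a - b|² = 0`. The weights may
  -- have opposite signs, so it does not matter which of the three points would lie between the
  -- others.
  sphere-strictly-convex : α ≢ ⁺ 0 → β ≢ ⁺ 0 → {a b c : Fin D → ℤ} {r : ℤ} → sq a ≡ r → sq b ≡ r → sq c ≡ r →
    (∀ d → α ℤ.* a d ℤ.+ β ℤ.* b d ≡ γ ℤ.* c d) → ∀ d → a d ≡ b d
  sphere-strictly-convex α≢0 β≢0 {a} {b} {c} {r} ra rb rc h d = ℤ.i-j≡0⇒i≡j (a d) (b d) (sq≡0 _ Q≡0 d)
    where
    open ≡-Reasoning
    Q = sq (λ d → a d ℤ.- b d)
    αβQ≡0 : α ℤ.* β ℤ.* Q ≡ ⁺ 0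
    αβQ≡0 = begin
      α ℤ.* β ℤ.* Q                                                ≡⟨ cancel (α ℤ.* β ℤ.* Q) (γ ℤ.* γ ℤ.* sq c) ⟩
      (α ℤ.* β ℤ.* Q ℤ.+ γ ℤ.* γ ℤ.* sq c) ℤ.- γ ℤ.* γ ℤ.* sq c    ≡⟨ cong (ℤ._- γ ℤ.* γ ℤ.* sq c) (convexity-identity a b c h) ⟩
      γ ℤ.* (α ℤ.* sq a ℤ.+ β ℤ.* sq b) ℤ.- γ ℤ.* γ ℤ.* sq c
        ≡⟨ cong₂ (λ u v → γ ℤ.* u ℤ.- γ ℤ.* γ ℤ.* v) (cong₂ (λ u v → α ℤ.* u ℤ.+ β ℤ.* v) ra rb) rc ⟩
      γ ℤ.* (α ℤ.* r ℤ.+ β ℤ.* r) ℤ.- γ ℤ.* γ ℤ.* r                ≡⟨ vanish α β r ⟩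
      ⁺ 0 ∎
      where
      cancel : ∀ x y → x ≡ (x ℤ.+ y) ℤ.- y
      cancel = ℤ.solve-∀
      vanish : ∀ α β r → (α ℤ.+ β) ℤ.* (α ℤ.* r ℤ.+ β ℤ.* r) ℤ.- (α ℤ.+ β) ℤ.* (α ℤ.+ β) ℤ.* r ≡ ⁺ 0
      vanish = ℤ.solve-∀
    Q≡0 : Q ≡ ⁺ 0
    Q≡0 with ℤ.i*j≡0⇒i≡0∨j≡0 (α ℤ.* β) αβQ≡0
    ... | inj₂ z = z
    ... | inj₁ z with ℤ.i*j≡0⇒i≡0∨j≡0 α z
    ... | inj₁ z′ = contradiction z′ α≢0
    ... | inj₂ z′ = contradiction z′ β≢0

-- The recursion of `cliques` is Pascal's rule.
length-cliques : ∀ n k → length (cliques n k) ≡ n C k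
length-cliques zero    zero    = refl
length-cliques zero    (suc k) = refl
length-cliques (suc n) zero    = trans (length-map addOutside (cliques n zero)) (length-cliques n zero)
length-cliques (suc n) (suc k) = trans (length-++ (map addInside (cliques n k)))
  (trans (cong₂ _+_ (trans (length-map addInside (cliques n k)) (length-cliques n k))
                    (trans (length-map addOutside (cliques n (suc k))) (length-cliques n (suc k))))
         (nCk+nC[k+1]≡[n+1]C[k+1] n k))

abstract
  -- The position of an edge in `cliques t 2` serves as a colour, and there are `t C 2` positions.
  edgeCode : Edge t → ℕ
  edgeCode e = toℕ (Any.index (∈-cliques e))

  edgeCode-injective : {e f : Edge t} → edgeCode e ≡ edgeCode f → e ≡ f
  edgeCode-injective {t} {e} {f} eq = trans (lookup-index (∈-cliques e))
    (trans (cong (lookup (cliques t 2)) (Fin.toℕ-injective eq)) (sym (lookup-index (∈-cliques f))))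

avoid : (xs : List (Fin n)) → length xs < n → ∃ λ i → i ∉ xs
avoid {n} xs lt with Fin.any? (λ i → ¬? (i ∈? xs))
  where open DecMembership Fin._≟_ using (_∈?_)
... | yes p = p
... | no ¬p = contradiction
  (≤-trans (≤-reflexive (sym (length-allFin n)))
    (length-injective-≤ id (λ _ _ eq → eq) (λ {i} _ → decidable-stable (i ∈? xs) λ i∉ → ¬p (i , i∉)) (Unique.allFin⁺ n)))
  (<⇒≱ lt)
  where open DecMembership Fin._≟_ using (_∈?_)

injective⇒surjective : {f : Fin n → Fin n} → Injective _≡_ _≡_ f → ∀ j → ∃ λ i → f i ≡ j
injective⇒surjective {n} {f} inj j = range⁻ f (subst (j Sub.∈_) (sym (cong proj₁ full)) Sub.∈⊤)
  where
  full : rangeClique f inj ≡ (Sub.⊤ , Sub.∣⊤∣≡n n)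
  full = clique-⊆ (rangeClique f inj) (Sub.⊤ , Sub.∣⊤∣≡n n) (λ _ → Sub.∈⊤)

-- The colouring whose rainbow cliques are lines

module Lines {n t D H : ℕ} (Placed : Fin n → Set) (placed? : ∀ u → Dec (Placed u))
  (ρ : Fin n → Fin t) (pos : Fin n → Fin D → ℤ)
  (separated : ∀ {u v} → Placed u → Placed v → ρ u ≡ ρ v → (∀ d → pos u d ≡ pos v d) → u ≡ v)
  (dir : Fin H → Fin D → ℤ) (r : ℤ) (e₀ : Edge t) where

  -- The difference of roles, which is the denominator of the slope rather than the slope itself.
  slope : Fin n → Fin n → ℤ
  slope u v = ⁺ toℕ (ρ u) ℤ.- ⁺ toℕ (ρ v)

  -- The slope between `u` and `v` is `a`, with the denominator cleared. In this form it is an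
  -- equivalence relation for fixed `a`, and it makes sense for vertices of equal role too.
  record Aligned (a : Fin D → ℤ) (u v : Fin n) : Set where
    constructor align
    field
      at : ∀ d → pos u d ℤ.- pos v d ≡ slope u v ℤ.* a d
  open Aligned

  slope≢0 : ∀ {u v} → ρ u ≢ ρ v → slope u v ≢ ⁺ 0
  slope≢0 ρ≢ eq = ρ≢ (Fin.toℕ-injective (ℤ.+-injective (ℤ.i-j≡0⇒i≡j _ _ eq)))

  aligned-refl : ∀ a u → Aligned a u u
  aligned-refl a u = align λ d → lemma (pos u d) (⁺ toℕ (ρ u)) (a d)
    where
    lemma : ∀ x i b → x ℤ.- x ≡ (i ℤ.- i) ℤ.* b
    lemma = ℤ.solve-∀

  aligned-sym : ∀ {a u v} → Aligned a u v → Aligned a v u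
  aligned-sym {a} {u} {v} h = align λ d → trans (flip (pos v d) (pos u d))
    (trans (cong ℤ.-_ (at h d)) (lemma (⁺ toℕ (ρ u)) (⁺ toℕ (ρ v)) (a d)))
    where
    flip : ∀ x y → x ℤ.- y ≡ ℤ.- (y ℤ.- x)
    flip = ℤ.solve-∀
    lemma : ∀ i j b → ℤ.- ((i ℤ.- j) ℤ.* b) ≡ (j ℤ.- i) ℤ.* b
    lemma = ℤ.solve-∀

  aligned-trans : ∀ {a u v w} → Aligned a u v → Aligned a v w → Aligned a u w
  aligned-trans {a} {u} {v} {w} h h′ = align λ d → trans (telescope (pos u d) (pos v d) (pos w d))
    (trans (cong₂ ℤ._+_ (at h d) (at h′ d)) (lemma (⁺ toℕ (ρ u)) (⁺ toℕ (ρ v)) (⁺ toℕ (ρ w)) (a d)))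
    where
    telescope : ∀ x y z → x ℤ.- z ≡ (x ℤ.- y) ℤ.+ (y ℤ.- z)
    telescope = ℤ.solve-∀
    lemma : ∀ i j k b → (i ℤ.- j) ℤ.* b ℤ.+ (j ℤ.- k) ℤ.* b ≡ (i ℤ.- k) ℤ.* b
    lemma = ℤ.solve-∀

  aligned-cong : ∀ {a b u v} → (∀ d → a d ≡ b d) → Aligned a u v → Aligned b u v
  aligned-cong {u = u} {v} a≗b h = align λ d → trans (at h d) (cong (slope u v ℤ.*_) (a≗b d))

  aligned-unique : ∀ {a b u v} → ρ u ≢ ρ v → Aligned a u v → Aligned b u v → ∀ d → a d ≡ b d
  aligned-unique {u = u} {v} ρ≢ h h′ d =
    ℤ.*-cancelˡ-≡ (slope u v) _ _ {{ℤ.≢-nonZero (slope≢0 {u} {v} ρ≢)}} (trans (sym (at h d)) (at h′ d))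

  -- `slope u v` and `slope v w` add up to `slope u w`, so the combination of `a` and `b` with these
  -- weights is `c` times the total weight, and strict convexity of the sphere applies.
  aligned-triangle : ∀ {a b c u v w} → ρ u ≢ ρ v → ρ v ≢ ρ w → sq a ≡ r → sq b ≡ r → sq c ≡ r →
    Aligned a u v → Aligned b v w → Aligned c u w → ∀ d → a d ≡ b d
  aligned-triangle {a} {b} {c} {u} {v} {w} ρ≢ ρ≢′ ra rb rc h h′ h″ =
    sphere-strictly-convex (slope u v) (slope v w) (slope≢0 {u} {v} ρ≢) (slope≢0 {v} {w} ρ≢′) ra rb rc λ d → begin
      slope u v ℤ.* a d ℤ.+ slope v w ℤ.* b d                    ≡⟨ cong₂ ℤ._+_ (at h d) (at h′ d) ⟨
      (pos u d ℤ.- pos v d) ℤ.+ (pos v d ℤ.- pos w d)            ≡⟨ telescope (pos u d) (pos v d) (pos w d) ⟩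
      pos u d ℤ.- pos w d                                        ≡⟨ at h″ d ⟩
      slope u w ℤ.* c d                                          ≡⟨ cong (ℤ._* c d) (telescope (⁺ toℕ (ρ u)) (⁺ toℕ (ρ v)) (⁺ toℕ (ρ w))) ⟨
      (slope u v ℤ.+ slope v w) ℤ.* c d                          ∎
    where
    open ≡-Reasoning
    telescope : ∀ x y z → (x ℤ.- y) ℤ.+ (y ℤ.- z) ≡ x ℤ.- z
    telescope = ℤ.solve-∀

  record Linked (u v : Fin n) : Set where
    constructor linked
    field
      placedˡ   : Placed u
      placedʳ   : Placed v
      ρ-distinct : ρ u ≢ ρ v
      a         : Fin H
      norm      : sq (dir a) ≡ r
      aligned   : Aligned (dir a) u v

  linked-sym : ∀ {u v} → Linked u v → Linked v u
  linked-sym {u} {v} (linked p p′ ρ≢ a ra h) = linked p′ p (ρ≢ ∘ sym) a ra (aligned-sym h)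

  linked? : ∀ u v → Dec (Linked u v)
  linked? u v = map′ (λ (p , p′ , ρ≢ , a , ra , h) → linked p p′ ρ≢ a ra (align h))
    (λ (linked p p′ ρ≢ a ra (align h)) → p , p′ , ρ≢ , a , ra , h)
    (placed? u ×-dec placed? v ×-dec ¬? (ρ u Fin.≟ ρ v) ×-dec
      Fin.any? λ a → (sq (dir a) ℤ.≟ r) ×-dec Fin.all? λ d → (pos u d ℤ.- pos v d) ℤ.≟ (slope u v ℤ.* dir a d))

  -- Unlinked pairs reuse the colour of `e₀`, which linked pairs with the roles of `e₀` also have. A
  -- separate default colour would exceed `t C 2`.
  tintOf : ∀ u v → Dec (Linked u v) → ℕ
  tintOf u v (yes l) = edgeCode (edge (ρ u) (ρ v) (Linked.ρ-distinct l))
  tintOf u v (no _)  = edgeCode e₀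

  tint : Fin n → Fin n → ℕ
  tint u v = tintOf u v (linked? u v)

  tintOf-linked : ∀ {u v} d → Linked u v → (ρ≢ : ρ u ≢ ρ v) → tintOf u v d ≡ edgeCode (edge (ρ u) (ρ v) ρ≢)
  tintOf-linked (yes l) _ ρ≢ = cong edgeCode (edge-cong (Linked.ρ-distinct l) ρ≢ refl refl)
  tintOf-linked (no ¬l) l ρ≢ = contradiction l ¬l

  tintOf-unlinked : ∀ {u v} d → ¬ Linked u v → tintOf u v d ≡ edgeCode e₀
  tintOf-unlinked (yes l) ¬l = contradiction l ¬l
  tintOf-unlinked (no _)  ¬l = refl

  tint-linked : ∀ {u v} → Linked u v → (ρ≢ : ρ u ≢ ρ v) → tint u v ≡ edgeCode (edge (ρ u) (ρ v) ρ≢)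
  tint-linked {u} {v} = tintOf-linked (linked? u v)

  tint-unlinked : ∀ {u v} → ¬ Linked u v → tint u v ≡ edgeCode e₀
  tint-unlinked {u} {v} = tintOf-unlinked (linked? u v)

  tint-sym : ∀ u v → tint u v ≡ tint v u
  tint-sym u v = by (linked? u v)
    where
    by : Dec (Linked u v) → tint u v ≡ tint v u
    by (yes l) = trans (tint-linked l ρ≢) (trans
      (cong edgeCode (edge-unique ρ≢ (edge (ρ v) (ρ u) (ρ≢ ∘ sym)) (edge⁺ʳ (ρ≢ ∘ sym)) (edge⁺ˡ (ρ≢ ∘ sym))))
      (sym (tint-linked (linked-sym l) (ρ≢ ∘ sym))))
      where ρ≢ = Linked.ρ-distinct l
    by (no ¬l) = trans (tint-unlinked ¬l) (sym (tint-unlinked (¬l ∘ linked-sym)))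

  tintOf∈ : ∀ u v d → tintOf u v d ∈ map edgeCode (cliques t 2)
  tintOf∈ u v (yes l) = ∈-map⁺ edgeCode (∈-cliques (edge (ρ u) (ρ v) (Linked.ρ-distinct l)))
  tintOf∈ u v (no _)  = ∈-map⁺ edgeCode (∈-cliques e₀)

  abstract
    lineColouring : Colouring n
    lineColouring e = tint (vertex e zero) (vertex e (suc zero))

    lineColouring-edge : ∀ {u v} (u≢v : u ≢ v) → lineColouring (edge u v u≢v) ≡ tint u v
    lineColouring-edge {u} {v} u≢v = by (edge⁻ u≢v (vertex∈ e zero)) (edge⁻ u≢v (vertex∈ e (suc zero)))
      where
      e : Edge n
      e = edge u v u≢v
      distinct : vertex e zero ≢ vertex e (suc zero)
      distinct eq = contradiction (vertex-injective e eq) λ ()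
      by : vertex e zero ≡ u ⊎ vertex e zero ≡ v → vertex e (suc zero) ≡ u ⊎ vertex e (suc zero) ≡ v →
        lineColouring e ≡ tint u v
      by (inj₁ p) (inj₂ q) = cong₂ tint p q
      by (inj₂ p) (inj₁ q) = trans (cong₂ tint p q) (tint-sym v u)
      by (inj₁ p) (inj₁ q) = contradiction (trans p (sym q)) distinct
      by (inj₂ p) (inj₂ q) = contradiction (trans p (sym q)) distinct

    lineColouring-palette : UsesAtMost (t C 2) lineColouring
    lineColouring-palette = map edgeCode (cliques t 2) ,
      trans (length-map edgeCode (cliques t 2)) (length-cliques t 2) , λ e → tintOf∈ _ _ (linked? _ _)

  module _ (4≤t : 4 ≤ t) where

    module RainbowClique (K : Clique n t) (rb : Rainbow lineColouring K) where

      vtx : Fin t → Fin n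
      vtx = vertex K

      vtx-distinct : ∀ {i j} → i ≢ j → vtx i ≢ vtx j
      vtx-distinct i≢j eq = i≢j (vertex-injective K eq)

      -- Two unlinked pairs both have the default colour, so in a rainbow clique they are the same
      -- edge.
      unlinked-unique : ∀ {i j i′ j′} → i ≢ j → i′ ≢ j′ → ¬ Linked (vtx i) (vtx j) → ¬ Linked (vtx i′) (vtx j′) → j′ ≡ i ⊎ j′ ≡ j
      unlinked-unique {i} {j} {i′} {j′} i≢j i′≢j′ ¬l ¬l′ =
        by (edge⁻ hub (subst (λ e → vtx j′ Sub.∈ proj₁ e) (sym same) (edge⁺ʳ p′)))
        where
        hub = vtx-distinct i≢j
        p′ = vtx-distinct i′≢j′
        same : edge (vtx i) (vtx j) hub ≡ edge (vtx i′) (vtx j′) p′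
        same = rb (edge (vtx i) (vtx j) hub) (edge (vtx i′) (vtx j′) p′)
          (edge-⊆ hub (vertex∈ K i) (vertex∈ K j)) (edge-⊆ p′ (vertex∈ K i′) (vertex∈ K j′))
          (trans (trans (lineColouring-edge hub) (tint-unlinked ¬l)) (sym (trans (lineColouring-edge p′) (tint-unlinked ¬l′))))
        by : vtx j′ ≡ vtx i ⊎ vtx j′ ≡ vtx j → j′ ≡ i ⊎ j′ ≡ j
        by (inj₁ eq) = inj₁ (vertex-injective K eq)
        by (inj₂ eq) = inj₂ (vertex-injective K eq)

      Central : Fin t → Set
      Central hub = ∀ m → m ≢ hub → Linked (vtx m) (vtx hub)

      record Axis : Set where
        field
          hub hub′  : Fin t
          hub≢hub′  : hub ≢ hub′
          to-hub : Central hub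
          to-hub′ : Central hub′

      -- At most one edge has the default colour because it is not linked, and t ≥ 4 leaves two vertices off it.
      central : Axis
      central = by (Fin.any? λ i → Fin.any? λ j → ¬? (i Fin.≟ j) ×-dec ¬? (linked? (vtx i) (vtx j)))
        where
        outside-two : ∀ i j → ∃₂ λ hub hub′ → hub ≢ hub′ × (hub ≢ i × hub ≢ j) × (hub′ ≢ i × hub′ ≢ j)
        outside-two i j =
          let hub , p∉ = avoid (i ∷ j ∷ []) (≤-trans (s≤s (s≤s (s≤s z≤n))) 4≤t)
              hub′ , q∉ = avoid (hub ∷ i ∷ j ∷ []) 4≤t
          in hub , hub′ , (λ p≡q → q∉ (here (sym p≡q))) ,
             ((λ p≡i → p∉ (here p≡i)) , λ p≡j → p∉ (there (here p≡j))) ,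
             ((λ q≡i → q∉ (there (here q≡i))) , λ q≡j → q∉ (there (there (here q≡j))))
        by : Dec (∃ λ i → ∃ λ j → i ≢ j × ¬ Linked (vtx i) (vtx j)) → Axis
        by (no all-linked) =
          let i , _ = avoid [] (≤-trans (s≤s z≤n) 4≤t)
              hub , hub′ , hub≢hub′ , _ = outside-two i i
              always m j m≢j = decidable-stable (linked? (vtx m) (vtx j)) λ ¬l → all-linked (m , j , m≢j , ¬l)
          in record { hub = hub ; hub′ = hub′ ; hub≢hub′ = hub≢hub′ ; to-hub = λ m → always m hub ; to-hub′ = λ m → always m hub′ }
        by (yes (i , j , i≢j , ¬l)) =
          let hub , hub′ , hub≢hub′ , (p≢i , p≢j) , (q≢i , q≢j) = outside-two i j
          in record { hub = hub ; hub′ = hub′ ; hub≢hub′ = hub≢hub′ ; to-hub = off p≢i p≢j ; to-hub′ = off q≢i q≢j }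
          where
          off : ∀ {hub} → hub ≢ i → hub ≢ j → Central hub
          off {hub} p≢i p≢j m m≢p = decidable-stable (linked? (vtx m) (vtx hub)) λ ¬l′ →
            either (unlinked-unique i≢j m≢p ¬l ¬l′)
            where
            either : hub ≡ i ⊎ hub ≡ j → _
            either (inj₁ eq) = p≢i eq
            either (inj₂ eq) = p≢j eq

      open Axis central

      axis : Linked (vtx hub′) (vtx hub)
      axis = to-hub hub′ (hub≢hub′ ∘ sym)

      direction : Fin D → ℤ
      direction = dir (Linked.a axis)

      -- In the linked triangle formed by `m`, `hub` and `hub′`, the slope from `m` to `hub` equals
      -- that of the axis.
      onLine : ∀ m → Aligned direction (vtx m) (vtx hub)
      onLine m = by (m Fin.≟ hub) (m Fin.≟ hub′)
        where
        by : Dec (m ≡ hub) → Dec (m ≡ hub′) → Aligned direction (vtx m) (vtx hub)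
        by (yes refl) _          = aligned-refl direction (vtx m)
        by (no _)     (yes refl) = Linked.aligned axis
        by (no m≢p)   (no m≢q)   = aligned-cong
          (aligned-triangle (ρ-distinct mp) (ρ-distinct axis ∘ sym) (norm mp) (norm axis) (norm mq)
            (aligned mp) (aligned-sym (aligned axis)) (aligned mq))
          (aligned mp)
          where
          open Linked
          mp = to-hub m m≢p
          mq = to-hub′ m m≢q

      placed : ∀ m → Placed (vtx m)
      placed m = by (m Fin.≟ hub)
        where
        by : Dec (m ≡ hub) → Placed (vtx m)
        by (yes refl) = Linked.placedʳ axis
        by (no m≢p)   = Linked.placedˡ (to-hub m m≢p)

      onLine∈ : ∀ {u v} → u Sub.∈ proj₁ K → v Sub.∈ proj₁ K → Aligned direction u v
      onLine∈ u∈ v∈ =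
        let i , i≡ = vertex-surjective K u∈
            j , j≡ = vertex-surjective K v∈
        in subst₂ (Aligned direction) i≡ j≡ (aligned-trans (onLine i) (aligned-sym (onLine j)))

      placed∈ : ∀ {u} → u Sub.∈ proj₁ K → Placed u
      placed∈ u∈ = let i , i≡ = vertex-surjective K u∈ in subst Placed i≡ (placed i)

    aligned-separated : ∀ {a u v} → Placed u → Placed v → Aligned a u v → ρ u ≡ ρ v → u ≡ v
    aligned-separated {a} {u} {v} pu pv h ρ≡ = separated pu pv ρ≡ λ d → ℤ.i-j≡0⇒i≡j _ _
      (trans (at h d) (trans (cong (λ i → (⁺ toℕ i ℤ.- ⁺ toℕ (ρ v)) ℤ.* a d) ρ≡) (lemma (⁺ toℕ (ρ v)) (a d))))
      where
      lemma : ∀ i b → (i ℤ.- i) ℤ.* b ≡ ⁺ 0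
      lemma = ℤ.solve-∀

    -- The ends of a shared edge have different roles and fix the direction of both lines. The `t`
    -- vertices of `L` have distinct roles, so every role occurs, and a vertex `u` of `K` is
    -- compared with the vertex of `L` of the same role: both are on the same line, hence equal.
    lineColouring-almostGallai : AlmostGallai t lineColouring
    lineColouring-almostGallai K L rbK rbL K≢L (e , e⊆K , e⊆L) = K≢L (clique-⊆ K L K⊆L)
      where
      module 𝒦 = RainbowClique K rbK
      module ℒ = RainbowClique L rbL
      x = vertex e zero
      y = vertex e (suc zero)
      x∈K = e⊆K (vertex∈ e zero)
      y∈K = e⊆K (vertex∈ e (suc zero))
      x∈L = e⊆L (vertex∈ e zero)
      y∈L = e⊆L (vertex∈ e (suc zero))
      ρx≢ρy : ρ x ≢ ρ y
      ρx≢ρy ρ≡ = contradiction (vertex-injective e (aligned-separated (𝒦.placed∈ x∈K) (𝒦.placed∈ y∈K) (𝒦.onLine∈ x∈K y∈K) ρ≡)) λ ()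
      same-direction : ∀ d → ℒ.direction d ≡ 𝒦.direction d
      same-direction = aligned-unique ρx≢ρy (ℒ.onLine∈ x∈L y∈L) (𝒦.onLine∈ x∈K y∈K)
      ρ-injective : Injective _≡_ _≡_ (ρ ∘ vertex L)
      ρ-injective {i} {j} ρ≡ = vertex-injective L
        (aligned-separated (ℒ.placed i) (ℒ.placed j) (ℒ.onLine∈ (vertex∈ L i) (vertex∈ L j)) ρ≡)
      K⊆L : proj₁ K Sub.⊆ proj₁ L
      K⊆L {u} u∈K = let j , ρ≡ = injective⇒surjective ρ-injective (ρ u) in subst (Sub._∈ proj₁ L)
        (aligned-separated (ℒ.placed j) (𝒦.placed∈ u∈K)
          (aligned-trans (aligned-cong same-direction (ℒ.onLine∈ (vertex∈ L j) x∈L)) (𝒦.onLine∈ x∈K u∈K)) ρ≡)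
        (vertex∈ L j)

  module _ {points : Fin t → Fin n} (ρ-points : ∀ i → ρ (points i) ≡ i) where

    points-injective : Injective _≡_ _≡_ points
    points-injective {i} {j} eq = trans (sym (ρ-points i)) (trans (cong ρ eq) (ρ-points j))

    lineClique : Clique n t
    lineClique = rangeClique points points-injective

    module _ (placed-points : ∀ i → Placed (points i)) (a : Fin H) (norm : sq (dir a) ≡ r)
      (aligned-points : ∀ i j → Aligned (dir a) (points i) (points j)) where

      colour-points : ∀ {i j} (i≢j : i ≢ j) p → lineColouring (edge (points i) (points j) p) ≡ edgeCode (edge i j i≢j)
      colour-points {i} {j} i≢j p = trans (lineColouring-edge p) (trans
        (tint-linked (linked (placed-points i) (placed-points j) ρ≢ a norm (aligned-points i j)) ρ≢)
        (cong edgeCode (edge-cong ρ≢ i≢j (ρ-points i) (ρ-points j))))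
        where
        ρ≢ : ρ (points i) ≢ ρ (points j)
        ρ≢ eq = i≢j (trans (sym (ρ-points i)) (trans eq (ρ-points j)))

      -- Points of roles `i` and `j` on the line are linked, so their edge has the code of the pair
      -- of roles as its colour, and distinct pairs have distinct codes.
      lineClique-rainbow : Rainbow lineColouring lineClique
      lineClique-rainbow e f e∈ f∈ eq =
        let i , j , i<j , p , e≡ = edge-in-range points points-injective e e∈
            i′ , j′ , i′<j′ , p′ , f≡ = edge-in-range points points-injective f f∈
            i≡i′ , j≡j′ = coincide i j i′ j′ i<j i′<j′ (λ eq → Fin.<-irrefl eq i<j) (λ eq → Fin.<-irrefl eq i′<j′) p p′ e≡ f≡
        in trans e≡ (trans (edge-cong p p′ (cong points i≡i′) (cong points j≡j′)) (sym f≡))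
        where
        open ≡-Reasoning
        coincide : ∀ i j i′ j′ → i Fin.< j → i′ Fin.< j′ → (i≢j : i ≢ j) (i′≢j′ : i′ ≢ j′) → ∀ p p′ →
          e ≡ edge (points i) (points j) p → f ≡ edge (points i′) (points j′) p′ → i ≡ i′ × j ≡ j′
        coincide i j i′ j′ i<j i′<j′ i≢j i′≢j′ p p′ e≡ f≡ =
          edge-of-range-injective (λ i → i) (λ eq → eq) {i} {j} {i′} {j′} i<j i′<j′ i≢j i′≢j′ (edgeCode-injective (begin
            edgeCode (edge i j i≢j)                            ≡⟨ colour-points i≢j p ⟨
            lineColouring (edge (points i) (points j) p)       ≡⟨ cong lineColouring e≡ ⟨
            lineColouring e                                    ≡⟨ eq ⟩
            lineColouring f                                    ≡⟨ cong lineColouring f≡ ⟩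
            lineColouring (edge (points i′) (points j′) p′)    ≡⟨ colour-points i′≢j′ p′ ⟩
            edgeCode (edge i′ j′ i′≢j′)                        ∎))

-- Coordinates for the vertices

funToFin-cong : {f g : Fin k → Fin m} → (∀ i → f i ≡ g i) → funToFin f ≡ funToFin g
funToFin-cong {zero}  h = refl
funToFin-cong {suc k} h = cong₂ combine (h zero) (funToFin-cong (h ∘ suc))

finToFun-injective : {x y : Fin (m ^ k)} → (∀ i → finToFun {m} {k} x i ≡ finToFun {m} {k} y i) → x ≡ y
finToFun-injective {m} {k} {x} {y} h = trans (sym (Fin.funToFin-finToFin {k} {m} x))
  (trans (funToFin-cong {f = finToFun {m} {k} x} {finToFun {m} {k} y} h) (Fin.funToFin-finToFin {k} {m} y))

module Layout (n t D B : ℕ) (z : Fin t) where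

  sites : ℕ
  sites = t * B ^ D

  -- The first `sites` vertices carry `t` copies of a box of side `B` in dimension `D`, one for each
  -- role.
  Placed : Fin n → Set
  Placed v = toℕ v < sites

  placed? : ∀ v → Dec (Placed v)
  placed? v = toℕ v <? sites

  -- The coordinates of a vertex that is not placed are junk.
  address : ∀ v → Dec (Placed v) → Fin t × (Fin D → ℕ)
  address v (yes v<) = let i , y = remQuot {t} (B ^ D) (fromℕ< v<) in i , λ d → toℕ (finToFun {B} {D} y d)
  address v (no _)   = z , λ _ → 0

  abstract
    role : Fin n → Fin t
    role v = proj₁ (address v (placed? v))

    coord : Fin n → Fin D → ℕ
    coord v = proj₂ (address v (placed? v))

    separated : ∀ {u v} → Placed u → Placed v → role u ≡ role v → (∀ d → coord u d ≡ coord v d) → u ≡ v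
    separated {u} {v} pu pv = by (placed? u) (placed? v)
      where
      by : ∀ (du : Dec (Placed u)) (dv : Dec (Placed v)) → proj₁ (address u du) ≡ proj₁ (address v dv) →
        (∀ d → proj₂ (address u du) d ≡ proj₂ (address v dv) d) → u ≡ v
      by (no ¬pu) _        _ _ = contradiction pu ¬pu
      by (yes _)  (no ¬pv) _ _ = contradiction pv ¬pv
      by (yes u<) (yes v<) i≡ y≡ = Fin.toℕ-injective (begin
        toℕ u                  ≡⟨ Fin.toℕ-fromℕ< u< ⟨
        toℕ (fromℕ< u<)        ≡⟨ cong toℕ (Fin.combine-remQuot {t} (B ^ D) (fromℕ< u<)) ⟨
        toℕ (combine i y)      ≡⟨ cong toℕ (cong₂ combine i≡ (finToFun-injective {B} {D} λ d → Fin.toℕ-injective (y≡ d))) ⟩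
        toℕ (combine i′ y′)    ≡⟨ cong toℕ (Fin.combine-remQuot {t} (B ^ D) (fromℕ< v<)) ⟩
        toℕ (fromℕ< v<)        ≡⟨ Fin.toℕ-fromℕ< v< ⟩
        toℕ v                  ∎)
        where
        open ≡-Reasoning
        i i′ : Fin t
        y y′ : Fin (B ^ D)
        i = proj₁ (remQuot {t} (B ^ D) (fromℕ< u<))
        y = proj₂ (remQuot {t} (B ^ D) (fromℕ< u<))
        i′ = proj₁ (remQuot {t} (B ^ D) (fromℕ< v<))
        y′ = proj₂ (remQuot {t} (B ^ D) (fromℕ< v<))

    point : sites ≤ n → Fin t → (Fin D → Fin B) → Fin n
    point sites≤n i y = inject≤ (combine i (funToFin y)) sites≤n

    placed-point : ∀ sites≤n i y → Placed (point sites≤n i y)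
    placed-point sites≤n i y =
      ≤-trans (s≤s (≤-reflexive (Fin.toℕ-inject≤ _ sites≤n))) (Fin.toℕ<n (combine i (funToFin y)))

    remQuot-point : ∀ sites≤n i y p< → remQuot {t} (B ^ D) (fromℕ< {toℕ (point sites≤n i y)} p<) ≡ (i , funToFin y)
    remQuot-point sites≤n i y p< = trans
      (cong (remQuot {t} (B ^ D)) (Fin.toℕ-injective (trans (Fin.toℕ-fromℕ< p<) (Fin.toℕ-inject≤ _ sites≤n))))
      (Fin.remQuot-combine i (funToFin y))

    role-point : ∀ sites≤n i y → role (point sites≤n i y) ≡ i
    role-point sites≤n i y = by (placed? (point sites≤n i y))
      where
      by : ∀ dp → proj₁ (address (point sites≤n i y) dp) ≡ i
      by (no ¬p)  = contradiction (placed-point sites≤n i y) ¬p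
      by (yes p<) = cong proj₁ (remQuot-point sites≤n i y p<)

    coord-point : ∀ sites≤n i y d → coord (point sites≤n i y) d ≡ toℕ (y d)
    coord-point sites≤n i y d = by (placed? (point sites≤n i y))
      where
      by : ∀ dp → proj₂ (address (point sites≤n i y) dp) d ≡ toℕ (y d)
      by (no ¬p)  = contradiction (placed-point sites≤n i y) ¬p
      by (yes p<) = cong toℕ (trans (cong (λ iy → finToFun {B} {D} (proj₂ iy) d) (remQuot-point sites≤n i y p<))
        (Fin.finToFun-funToFin y d))

sq-bound : ∀ {D h} (f : Fin D → ℕ) → (∀ d → f d ≤ h) → ∃ λ m → m ≤ D * (h * h) × sq (λ d → ⁺ f d) ≡ ⁺ m
sq-bound {zero}  f f≤h = 0 , z≤n , refl
sq-bound {suc D} f f≤h = let m , m≤ , eq = sq-bound (f ∘ suc) (f≤h ∘ suc) in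
  f zero * f zero + m , +-mono-≤ (*-mono-≤ (f≤h zero) (f≤h zero)) m≤ , cong₂ ℤ._+_ (sym (ℤ.pos-* (f zero) (f zero))) eq

-- Counting lines in the box

module Construction (t : ℕ) (4≤t : 4 ≤ t) where

  z : Fin t
  z = fromℕ< (≤-trans (s≤s z≤n) 4≤t)

  one : Fin t
  one = fromℕ< (≤-trans (s≤s (s≤s z≤n)) 4≤t)

  toℕ-z : toℕ z ≡ 0
  toℕ-z = Fin.toℕ-fromℕ< _

  toℕ-one : toℕ one ≡ 1
  toℕ-one = Fin.toℕ-fromℕ< _

  z≢one : z ≢ one
  z≢one eq = contradiction (trans (sym toℕ-z) (trans (cong toℕ eq) toℕ-one)) λ ()

  module _ (n D h : ℕ) where

    -- Side `t * h` leaves room for `x + i a` when `x` and `a` have entries below `h` and `i < t`.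
    module L = Layout n t D (t * h) z

    entry : Fin (h ^ D) → Fin D → ℕ
    entry a d = toℕ (finToFun {h} {D} a d)

    module Col (r : ℕ) = Lines L.Placed L.placed? L.role (λ v d → ⁺ L.coord v d)
      (λ pu pv ρ≡ x≡ → L.separated pu pv ρ≡ λ d → ℤ.+-injective (x≡ d))
      (λ a d → ⁺ entry a d) (⁺ r) (edge z one z≢one)

    module _ (sites≤n : L.sites ≤ n) where

      in-range : ∀ (x a : Fin (h ^ D)) (i : Fin t) d → entry x d + toℕ i * entry a d < t * h
      in-range x a i d = begin-strict
        entry x d + toℕ i * entry a d <⟨ +-mono-<-≤ (Fin.toℕ<n (finToFun {h} {D} x d))
                                           (*-monoʳ-≤ (toℕ i) (<⇒≤ (Fin.toℕ<n (finToFun {h} {D} a d)))) ⟩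
        suc (toℕ i) * h               ≤⟨ *-monoˡ-≤ h (Fin.toℕ<n i) ⟩
        t * h                         ∎
        where open ≤-Reasoning

      points : Fin (h ^ D) → Fin (h ^ D) → Fin t → Fin n
      points x a i = L.point sites≤n i (λ d → fromℕ< (in-range x a i d))

      role-points : ∀ x a i → L.role (points x a i) ≡ i
      role-points x a i = L.role-point sites≤n i _

      coord-points : ∀ x a i d → L.coord (points x a i) d ≡ entry x d + toℕ i * entry a d
      coord-points x a i d = trans (L.coord-point sites≤n i _ d) (Fin.toℕ-fromℕ< (in-range x a i d))

      -- The point of role 0 is at `x` and the point of role 1 at `x + a`.
      points-determine : ∀ {x a x′ a′} → (∀ i → points x a i ≡ points x′ a′ i) → x ≡ x′ × a ≡ a′
      points-determine {x} {a} {x′} {a′} same =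
        finToFun-injective {h} {D} (Fin.toℕ-injective ∘ x≡) , finToFun-injective {h} {D} (Fin.toℕ-injective ∘ a≡)
        where
        coords : ∀ i d → entry x d + toℕ i * entry a d ≡ entry x′ d + toℕ i * entry a′ d
        coords i d = trans (sym (coord-points x a i d)) (trans (cong (λ v → L.coord v d) (same i)) (coord-points x′ a′ i d))
        x≡ : ∀ d → entry x d ≡ entry x′ d
        x≡ d = trans (sym (+-identityʳ _)) (trans
          (subst (λ i → entry x d + i * entry a d ≡ entry x′ d + i * entry a′ d) toℕ-z (coords z d)) (+-identityʳ _))
        a≡ : ∀ d → entry a d ≡ entry a′ d
        a≡ d = +-cancelˡ-≡ (entry x d) _ _ (trans (cong (entry x d +_) (sym (*-identityˡ _))) (trans
          (subst (λ i → entry x d + i * entry a d ≡ entry x′ d + i * entry a′ d) toℕ-one (coords one d))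
          (cong₂ _+_ (sym (x≡ d)) (*-identityˡ _))))

      clique : ℕ → Fin (h ^ D) × Fin (h ^ D) → Clique n t
      clique r (x , a) = Col.lineClique r (role-points x a)

      -- A clique is an unordered set, but the roles recover the parametrisation of its points.
      clique-injective : ∀ r {xa xa′} → clique r xa ≡ clique r xa′ → xa ≡ xa′
      clique-injective r {x , a} {x′ , a′} eq =
        let x≡ , a≡ = points-determine {x} {a} {x′} {a′} same in cong₂ _,_ x≡ a≡
        where
        same : ∀ i → points x a i ≡ points x′ a′ i
        same i = let j , j≡ = range⁻ (points x′ a′) (subst (points x a i Sub.∈_) (cong proj₁ eq) (range⁺ (points x a) i))
                     j≡i = trans (sym (role-points x′ a′ j)) (trans (cong L.role j≡) (role-points x a i))
                 in trans (sym j≡) (cong (points x′ a′) j≡i)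

      aligned-points : ∀ r x a i j → Col.Aligned r (λ d → ⁺ entry a d) (points x a i) (points x a j)
      aligned-points r x a i j = Col.align λ d → trans
        (cong₂ (λ u v → ⁺ u ℤ.- ⁺ v) (coord-points x a i d) (coord-points x a j d))
        (trans (lemma′ (entry x d) (toℕ i) (toℕ j) (entry a d))
          (cong₂ (λ u v → (⁺ toℕ u ℤ.- ⁺ toℕ v) ℤ.* ⁺ entry a d) (sym (role-points x a i)) (sym (role-points x a j))))
        where
        lemma : ∀ x i j a → (x ℤ.+ i ℤ.* a) ℤ.- (x ℤ.+ j ℤ.* a) ≡ (i ℤ.- j) ℤ.* a
        lemma = ℤ.solve-∀
        lemma′ : ∀ x i j a → ⁺ (x + i * a) ℤ.- ⁺ (x + j * a) ≡ (⁺ i ℤ.- ⁺ j) ℤ.* ⁺ a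
        lemma′ x i j a = trans (cong₂ ℤ._-_ (cast i) (cast j)) (lemma (⁺ x) (⁺ i) (⁺ j) (⁺ a))
          where
          cast : ∀ i → ⁺ (x + i * a) ≡ ⁺ x ℤ.+ ⁺ i ℤ.* ⁺ a
          cast i = trans (ℤ.pos-+ x (i * a)) (cong (λ y → ⁺ x ℤ.+ y) (ℤ.pos-* i a))

      pairs : List (Fin (h ^ D) × Fin (h ^ D))
      pairs = cartesianProduct (allFin (h ^ D)) (allFin (h ^ D))

      onSphere? : ∀ r (xa : Fin (h ^ D) × Fin (h ^ D)) → Dec (sq (λ d → ⁺ entry (proj₂ xa) d) ≡ ⁺ r)
      onSphere? r xa = sq (λ d → ⁺ entry (proj₂ xa) d) ℤ.≟ ⁺ r

      sphere-count : ∀ r → length (filter (onSphere? r) pairs) ≤ rainbowCount t (Col.lineColouring r)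
      sphere-count r = length-injective-≤ (clique r) (λ _ _ → clique-injective r)
        (λ {xa} xa∈ → ∈-filter⁺ (rainbow? (Col.lineColouring r)) (∈-cliques (clique r xa))
          (Col.lineClique-rainbow r (role-points (proj₁ xa) (proj₂ xa)) (λ i → L.placed-point sites≤n i _) (proj₂ xa)
            (proj₂ (∈-filter⁻ (onSphere? r) {xs = pairs} xa∈)) (aligned-points r (proj₁ xa) (proj₂ xa))))
        (Unique.filter⁺ (onSphere? r) (Unique.cartesianProduct⁺ (Unique.allFin⁺ (h ^ D)) (Unique.allFin⁺ (h ^ D))))

      -- The squared norm of a direction with entries at most `h` lies between 0 and `D * (h * h)`.
      radii : ℕ
      radii = suc (D * (h * h))

      -- Every pair of a base point and a direction gives a line, and each direction has one of
      -- `radii` possible squared norms, so some norm accounts for at least the average number of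
      -- lines.
      popular-radius : ∃ λ r → r < radii × h ^ D * h ^ D ≤ radii * rainbowCount t (Col.lineColouring r)
      popular-radius =
        let r , _ , bd = ∑-averaging (allFin radii) (λ r → length (filter (onSphere? (toℕ r)) pairs)) (s≤s z≤n) total
        in toℕ r , Fin.toℕ<n r , ≤-trans bd (*-mono-≤ (≤-reflexive (length-allFin radii)) (sphere-count (toℕ r)))
        where
        open ≤-Reasoning
        some-radius : ∀ xa → 1 ≤ ∑[ r < radii ] ⟦ does (onSphere? (toℕ r) xa) ⟧
        some-radius xa =
          let m , m≤ , eq = sq-bound (entry (proj₂ xa)) (λ d → <⇒≤ (Fin.toℕ<n (finToFun {h} {D} (proj₂ xa) d)))
              r = fromℕ< (s≤s m≤)
          in ≤-trans (≤-reflexive (cong ⟦_⟧ (sym (dec-true (onSphere? (toℕ r) xa)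
               (trans eq (cong ⁺_ (sym (Fin.toℕ-fromℕ< (s≤s m≤)))))))))
             (term≤∑ (λ r → ⟦ does (onSphere? (toℕ r) xa) ⟧) (∈-allFin r))
        total : h ^ D * h ^ D ≤ ∑[ r < radii ] length (filter (onSphere? (toℕ r)) pairs)
        total = begin
          h ^ D * h ^ D                                                ≡⟨ cong₂ _*_ (length-allFin (h ^ D)) (length-allFin (h ^ D)) ⟨
          length (allFin (h ^ D)) * length (allFin (h ^ D))            ≡⟨ cong (length (allFin (h ^ D)) *_) (∑-one (allFin (h ^ D))) ⟨
          length (allFin (h ^ D)) * ∑[ a < h ^ D ] 1                   ≡⟨ ∑-const (allFin (h ^ D)) _ ⟨
          ∑[ x < h ^ D ] ∑[ a < h ^ D ] 1                              ≡⟨ ∑-× (allFin (h ^ D)) (allFin (h ^ D)) (λ _ → 1) ⟨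
          ∑[ _ ∈ pairs ] 1                                             ≤⟨ ∑-mono pairs some-radius ⟩
          ∑[ xa ∈ pairs ] ∑[ r < radii ] ⟦ does (onSphere? (toℕ r) xa) ⟧ ≡⟨ ∑-swap pairs (allFin radii) _ ⟩
          ∑[ r < radii ] ∑[ xa ∈ pairs ] ⟦ does (onSphere? (toℕ r) xa) ⟧ ≡⟨ ∑-cong (allFin radii) (λ r → ∑-filter (onSphere? (toℕ r)) pairs) ⟩
          ∑[ r < radii ] length (filter (onSphere? (toℕ r)) pairs)     ∎

-- Choosing the dimension and the side length

^-distribʳ-* : ∀ m n o → (m * n) ^ o ≡ m ^ o * n ^ o
^-distribʳ-* m n zero    = refl
^-distribʳ-* m n (suc o) = trans (cong (m * n *_) (^-distribʳ-* m n o)) (lemma m n (m ^ o) (n ^ o))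
  where
  lemma : ∀ m n a b → m * n * (a * b) ≡ m * a * (n * b)
  lemma = solve-∀

n≤n^k : ∀ n k .{{_ : NonZero k}} → n ≤ n ^ k
n≤n^k zero      k = z≤n
n≤n^k n@(suc _) k = ≤-trans (≤-reflexive (sym (*-identityʳ n))) (^-monoʳ-≤ n (>-nonZero⁻¹ k))

-- An upward search from `h`, with `k` as fuel, for a place where `g` passes `n`.
last-below : ∀ (g : ℕ → ℕ) {n} k h → g h ≤ n → n < g (k + h) → ∃ λ h′ → h ≤ h′ × g h′ ≤ n × n < g (suc h′)
last-below g zero    h gh≤n n<gh = contradiction n<gh (≤⇒≯ gh≤n)
last-below g {n} (suc k) h gh≤n n<g with n <? g (suc h)
... | yes n<gsh = h , ≤-refl , gh≤n , n<gsh
... | no  n≮gsh =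
  let h′ , sh≤h′ , rest = last-below g k (suc h) (≮⇒≥ n≮gsh) (subst (λ m → n < g m) (sym (+-suc k h)) n<g)
  in h′ , ≤-trans (n≤1+n h) sh≤h′ , rest

argmax-max : ∀ {X : Set} (f : X → ℕ) x₀ {xs x} → x ∈ xs → f x ≤ f (Extrema.argmax f x₀ xs)
argmax-max f x₀ {xs} = All.lookup (Extrema.f[xs]≤f[argmax] {f = f} x₀ xs)

module Asymptotics (t : ℕ) .{{_ : NonZero t}} (f : ℕ → ℕ)
  (f-large : ∀ n D h → D ≤ n → h ≤ n → t * (t * h) ^ D ≤ n → h ^ D * h ^ D ≤ suc (D * (h * h)) * f n) where

  module _ (D : ℕ) .{{_ : NonZero D}} where

    sites : ℕ → ℕ
    sites h = t * (t * h) ^ D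

    -- `scale` compares `n` with `h ^ D` when `n < sites (suc h)`; `loss` collects the factors of
    -- `square-bound` that depend only on `t` and `D`.
    scale loss : ℕ
    scale = t * (2 * t) ^ D
    loss = scale * scale * suc D

    h^D≤sites : ∀ h → h ^ D ≤ sites h
    h^D≤sites h = ≤-trans (^-monoˡ-≤ D (m≤n*m h t)) (m≤n*m ((t * h) ^ D) t)

    h≤sites : ∀ h → h ≤ sites h
    h≤sites h = ≤-trans (n≤n^k h D) (h^D≤sites h)

    sites-suc : ∀ h → 1 ≤ h → sites (suc h) ≤ scale * h ^ D
    sites-suc h 1≤h = begin
      t * (t * suc h) ^ D         ≤⟨ *-monoʳ-≤ t (^-monoˡ-≤ D (*-monoʳ-≤ t (+-monoˡ-≤ h 1≤h))) ⟩
      t * (t * (h + h)) ^ D       ≡⟨ cong (λ m → t * m ^ D) (double t h) ⟩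
      t * (2 * t * h) ^ D         ≡⟨ cong (t *_) (^-distribʳ-* (2 * t) h D) ⟩
      t * ((2 * t) ^ D * h ^ D)   ≡⟨ *-assoc t ((2 * t) ^ D) (h ^ D) ⟨
      scale * h ^ D               ∎
      where
      open ≤-Reasoning
      double : ∀ t h → t * (h + h) ≡ 2 * t * h
      double = solve-∀

    square-bound : ∀ n h → D ≤ n → 1 ≤ h → sites h ≤ n → n < sites (suc h) → n * n ≤ loss * (h * h) * f n
    square-bound n h D≤n 1≤h sites≤n n<sites = begin
      n * n                                          ≤⟨ *-mono-≤ n≤ n≤ ⟩
      scale * h ^ D * (scale * h ^ D)                ≡⟨ eq₁ scale (h ^ D) ⟩
      scale * scale * (h ^ D * h ^ D)                ≤⟨ *-monoʳ-≤ (scale * scale) (f-large n D h D≤n h≤n sites≤n) ⟩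
      scale * scale * (suc (D * (h * h)) * f n)      ≤⟨ *-monoʳ-≤ (scale * scale) (*-monoˡ-≤ (f n) (+-monoˡ-≤ (D * (h * h)) (*-mono-≤ 1≤h 1≤h))) ⟩
      scale * scale * (suc D * (h * h) * f n)        ≡⟨ eq₂ (scale * scale) (suc D) (h * h) (f n) ⟩
      loss * (h * h) * f n                           ∎
      where
      open ≤-Reasoning
      n≤ : n ≤ scale * h ^ D
      n≤ = ≤-trans (<⇒≤ n<sites) (sites-suc h 1≤h)
      h≤n : h ≤ n
      h≤n = ≤-trans (h≤sites h) sites≤n
      eq₁ : ∀ s x → s * x * (s * x) ≡ s * s * (x * x)
      eq₁ = solve-∀
      eq₂ : ∀ s d x c → s * (d * x * c) ≡ s * d * x * c
      eq₂ = solve-∀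

    -- The search starts at `loss`, so that `loss ≤ h` and the constant can be absorbed by one more
    -- factor `h`. It succeeds because `h ≤ sites h`.
    suitable : ∀ n → sites loss ≤ n → ∃ λ h → loss ≤ h × sites h ≤ n × n < sites (suc h)
    suitable n sites≤n = last-below sites (suc n) loss sites≤n
      (≤-trans (s≤s (m≤m+n n loss)) (h≤sites (suc n + loss)))

    1≤loss : 1 ≤ loss
    1≤loss = *-mono-≤ (*-mono-≤ 1≤scale 1≤scale) (s≤s z≤n)
      where
      1≤scale : 1 ≤ scale
      1≤scale = *-mono-≤ (>-nonZero⁻¹ t) (m^n>0 (2 * t) {{m*n≢0 2 t}} D)

    -- From `loss ≤ h` follows `n ^ 2 ≤ h ^ 3 * f n`. The dimension `D = 3 * q` is chosen so that
    -- the `q`-th power of `h ^ 3` is `h ^ D`, which is at most `n` and so at most `n ^ p`.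
    power-bound : ∀ p q .{{_ : NonZero p}} → D ≡ 3 * q → ∀ n → D ≤ n → sites loss ≤ n →
      n ^ (2 * q) ≤ f n ^ q * n ^ p
    power-bound p q D≡ n D≤n sites≤n with suitable n sites≤n
    ... | h , loss≤h , sites-h≤n , n<sites = begin
      n ^ (2 * q)                               ≡⟨ ^-*-assoc n 2 q ⟨
      (n ^ 2) ^ q                               ≡⟨ cong (λ m → (n * m) ^ q) (*-identityʳ n) ⟩
      (n * n) ^ q                               ≤⟨ ^-monoˡ-≤ q (square-bound n h D≤n (≤-trans 1≤loss loss≤h) sites-h≤n n<sites) ⟩
      (loss * (h * h) * f n) ^ q                ≤⟨ ^-monoˡ-≤ q (*-monoˡ-≤ (f n) (*-monoˡ-≤ (h * h) loss≤h)) ⟩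
      (h * (h * h) * f n) ^ q                   ≡⟨ ^-distribʳ-* (h * (h * h)) (f n) q ⟩
      (h * (h * h)) ^ q * f n ^ q               ≡⟨ cong (λ m → (h * (h * m)) ^ q * f n ^ q) (*-identityʳ h) ⟨
      (h ^ 3) ^ q * f n ^ q                     ≡⟨ cong (_* f n ^ q) (trans (^-*-assoc h 3 q) (cong (h ^_) (sym D≡))) ⟩
      h ^ D * f n ^ q                           ≤⟨ *-monoˡ-≤ (f n ^ q) (≤-trans (h^D≤sites h) (≤-trans sites-h≤n (n≤n^k n p))) ⟩
      n ^ p * f n ^ q                           ≡⟨ *-comm (n ^ p) (f n ^ q) ⟩
      f n ^ q * n ^ p                           ∎
      where open ≤-Reasoning

  almost-quadratic : n^[ 2 -o1]≤ f
  almost-quadratic p q = 3 * q + sites (3 * q) (loss (3 * q)) , λ n n≥N →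
    power-bound (3 * q) p q refl n (m+n≤o⇒m≤o (3 * q) n≥N) (m+n≤o⇒n≤o (3 * q) n≥N)
    where
    instance
      3q≢0 : NonZero (3 * q)
      3q≢0 = m*n≢0 3 q

module LowerBound (t : ℕ) (4≤t : 4 ≤ t) where

  open Construction t 4≤t

  abstract
    candidate : ∀ n → ℕ × ℕ × ℕ → Colouring n
    candidate n (D , h , r) = Col.lineColouring n D h r

    candidate-almostGallai : ∀ n Dhr → AlmostGallai t (candidate n Dhr)
    candidate-almostGallai n (D , h , r) = Col.lineColouring-almostGallai n D h r 4≤t

    candidate-palette : ∀ n Dhr → UsesAtMost (t C 2) (candidate n Dhr)
    candidate-palette n (D , h , r) = Col.lineColouring-palette n D h r

    candidate-count : ∀ n D h → t * (t * h) ^ D ≤ n →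
      ∃ λ r → r < suc (D * (h * h)) × h ^ D * h ^ D ≤ suc (D * (h * h)) * rainbowCount t (candidate n (D , h , r))
    candidate-count = popular-radius

  score : ∀ n → ℕ × ℕ × ℕ → ℕ
  score n Dhr = rainbowCount t (candidate n Dhr)

  grid : ℕ → List (ℕ × ℕ × ℕ)
  grid n = cartesianProduct (upTo (suc n)) (cartesianProduct (upTo (suc n)) (upTo (suc (n * (n * n)))))

  ∈-grid : ∀ {n D h r} → D ≤ n → h ≤ n → r ≤ n * (n * n) → (D , h , r) ∈ grid n
  ∈-grid {n} D≤n h≤n r≤ = ∈-cartesianProduct⁺ {xs = upTo (suc n)} (∈-upTo⁺ (s≤s D≤n))
    (∈-cartesianProduct⁺ {xs = upTo (suc n)} (∈-upTo⁺ (s≤s h≤n)) (∈-upTo⁺ (s≤s r≤)))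

  -- The dimension has to grow with n for a single colouring to serve every ε; taking the best
  -- parameters avoids choosing its rate.
  best : ∀ n → ℕ × ℕ × ℕ
  best n = Extrema.argmax (score n) (0 , 0 , 0) (grid n)

  best-max : ∀ n {Dhr} → Dhr ∈ grid n → score n Dhr ≤ score n (best n)
  best-max n = argmax-max (score n) (0 , 0 , 0)

  -- The best parameters do at least as well as every `(D , h)` that fits, which allows `D` to be
  -- chosen afterwards in terms of `q`.
  best-large : ∀ n D h → D ≤ n → h ≤ n → t * (t * h) ^ D ≤ n → h ^ D * h ^ D ≤ suc (D * (h * h)) * score n (best n)
  best-large n D h D≤n h≤n sites≤n =
    let r , r< , many = candidate-count n D h sites≤n
    in ≤-trans many (*-monoʳ-≤ (suc (D * (h * h)))
         (best-max n (∈-grid D≤n h≤n (≤-trans (s≤s⁻¹ r<) (*-mono-≤ D≤n (*-mono-≤ h≤n h≤n))))))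

  colouring : ∀ n → Colouring n
  colouring n = candidate n (best n)

  many-rainbow : n^[ 2 -o1]≤ (λ n → rainbowCount t (colouring n))
  many-rainbow = Asymptotics.almost-quadratic t {{>-nonZero (≤-trans (s≤s z≤n) 4≤t)}} (λ n → score n (best n)) best-large

n^o1-mono : ∀ a {f g : ℕ → ℕ} → (∀ n → f n ≤ g n) → n^[ a -o1]≤ f → n^[ a -o1]≤ g
n^o1-mono a f≤g f-large p q = let N , bound = f-large p q in
  N , λ n n≥N → ≤-trans (bound n n≥N) (*-monoˡ-≤ (n ^ p) (^-monoˡ-≤ q (f≤g n)))

theorem1p1 : (∀ t → 3 ≤ t → LittleO (τ t) (λ n → n ^ 2)) ×
    (∀ t → 4 ≤ t → n^[ 2 -o1]≤ (τ t)) ×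
    (∀ t → 4 ≤ t →
    ∃ λ (c : ∀ n → Colouring n) →
    (∀ n → AlmostGallai t (c n)) ×
    (∀ n → UsesAtMost (t C 2) (c n)) ×
    n^[ 2 -o1]≤ (λ n → rainbowCount t (c n)))
theorem1p1 = τ-littleO , τ-large , λ t 4≤t → let open LowerBound t 4≤t in
  colouring , (λ n → candidate-almostGallai n (best n)) , (λ n → candidate-palette n (best n)) , many-rainbow
  where
  τ-large : ∀ t → 4 ≤ t → n^[ 2 -o1]≤ (τ t)
  τ-large t 4≤t = n^o1-mono 2
    (λ n → proj₂ (τ-isMax t n) (colouring n) (candidate-almostGallai n (best n))) many-rainbow
    where open LowerBound t 4≤t
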